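{- Let $n \geq 8$ be even, let $\tau_n := (1, 2, 3, n, n-1, n-2, \ldots, 6, 5, 4)$ be a cyclic order on $\{1,\ldots,n\}$, and let $c_n$ be the edge-coloring of $C(n,\{1,3\})$ with colors red, blue, green, purple defined in the context. Then $(C(n,\{1,3\}), \tau_n, c_n)$ is a dispersable matching book embedding.
   Context: All graphs are finite and simple. Write $[k]=\{1,\ldots,k\}$ (so $[0]=\emptyset$). For a set $S=\{i_1<\cdots<i_k\}$ of integers with $k\ge 1$, $1\le i_1$ and $i_k\le \lfloor n/2\rfloor$, the circulant $C(n,S)$ is the graph on vertex set $[n]$ in which each $j$ is adjacent to $j+i_r$ (addition mod $n$) for $r=1,\ldots,k$. Given a graph $G$ and a cyclic order $\omega$ on $V(G)$, draw the vertices on a circle in the order $\omega$ and the edges as straight chords; two edges cross if they intersect at a point that is not an endpoint. A matching book embedding $(G,\omega,c)$ consists of $G$, a cyclic order $\omega$, and an edge-coloring $c$ (the color classes are the pages) such that any two distinct edges of the same color neither cross nor share an endpoint. It is dispersable if the number of colors equals the maximum degree $\Delta(G)$. Write $u{ - }v$ for the edge joining $u$ and $v$. The coloring $c_n$ is as follows. First, the 10 "twist" edges are colored: Red: $1{ - }2$, $3{ - }4$. Blue: $2{ - }3$, $1{ - }n$. Green: $3{ - }n$, $2{ - }(n-1)$, $1{ - }(n-2)$. Purple: $1{ - }4$, $2{ - }5$, $3{ - }6$. The remaining edges are colored as follows. Case $n=4k$, $k\ge 2$: Blue: $a{ - }(a+3)$ and $(a+1){ - }(a+2)$ for $a=4t$,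 $t\in[k-1]$. Red: $a{ - }(a+3)$ and $(a+1){ - }(a+2)$ for $a=1+4t$, $t\in[k-1]$. Green: $a{ - }(a+3)$ and $(a+1){ - }(a+2)$ for $a=2+4t$, $t\in[k-2]$, and also $4{ - }5$. Purple: $a{ - }(a+3)$ and $(a+1){ - }(a+2)$ for $a=3+4t$, $t\in[k-2]$, and also $(n-1){ - }n$. Case $n=4k+2$, $k\ge 2$: Green: $a{ - }(a+3)$ and $(a+1){ - }(a+2)$ for $a=4t$, $t\in[k-1]$. Red: $a{ - }(a+3)$ and $(a+1){ - }(a+2)$ for $a=1+4t$, $t\in[k-1]$, and also $(n-1){ - }n$. Blue: $a{ - }(a+3)$ and $(a+1){ - }(a+2)$ for $a=2+4t$, $t\in[k-1]$, and also $4{ - }5$. Purple: $a{ - }(a+3)$ and $(a+1){ - }(a+2)$ for $a=3+4t$, $t\in[k-1]$. -}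

module Defs where

open import Data.Nat as ℕ using (ℕ; zero; suc; _≤_; z≤n; s≤s; _∸_; ⌊_/2⌋)
import Data.Nat.Properties as ℕ
open import Data.Nat.DivMod using (_mod_; _/_; _%_; m≡m%n+[m/n]*n)
open import Data.Nat.Divisibility using (divides; >⇒∤)
open import Data.Fin as Fin using (Fin; zero; suc; toℕ)
open import Data.Fin.Patterns using (0F; 1F; 2F; 3F)
open import Data.Fin.Permutation using (Permutation′; _⟨$⟩ʳ_; _⟨$⟩ˡ_; inverseˡ; reverse; lift₀)
import Data.Fin.Permutation as Perm
import Data.Fin.Properties as Fin
open import Data.List using (List; []; _∷_; _++_; length; filter; map; concatMap; allFin; applyUpTo)
open import Data.List.Extrema.Nat using (max)
open import Data.List.Membership.Propositional using (_∈_)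
open import Data.List.Relation.Unary.All using (All; []; _∷_)
import Data.List.Relation.Unary.All as All
open import Data.List.Relation.Unary.Any using (Any; any?)
import Data.List.Relation.Unary.Any as Any
open import Data.List.Relation.Unary.Linked using (Linked; [-]; _∷_)
open import Data.Product using (_×_; _,_; proj₁; proj₂; ∃₂; ∃-syntax)
open import Data.Rational as ℚ using (ℚ; 0ℚ; 1ℚ; _+_; _*_; _-_; -_; 1/_; Positive)
import Data.Rational.Properties as ℚ
open import Data.Rational.Solver using (module +-*-Solver)
open import Data.Sum using (_⊎_; inj₁; inj₂; swap; [_,_]′)
open import Level using (0ℓ)
open import Relation.Binary using (Rel; Symmetric; Irreflexive; Decidable)
open import Relation.Binary.PropositionalEquality
open import Relation.Nullary using (¬_)
open import Relation.Nullary.Decidable using (_⊎-dec_)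

private variable
  n k : ℕ

-- The vertex set [n] = {1, …, n} is Fin n, with u : Fin n standing for
-- the number label u.
label : Fin n → ℕ
label u = suc (toℕ u)

record Graph (n : ℕ) : Set₁ where
  field
    Adj        : Rel (Fin n) 0ℓ
    adj?       : Decidable Adj
    adj-sym    : Symmetric Adj
    adj-irrefl : Irreflexive _≡_ Adj

  degree : Fin n → ℕ
  degree u = length (filter (adj? u) (allFin n))

  maxDegree : ℕ
  maxDegree = max 0 (map degree (allFin n))

record ConnectionSet (n : ℕ) : Set where
  field
    first      : ℕ
    rest       : List ℕ
  elements : List ℕ
  elements = first ∷ rest
  field
    increasing : Linked ℕ._<_ elements
    bounded    : All (λ i → 1 ≤ i × i ≤ ⌊ n /2⌋) elements

-- Addition mod n on [n].  Shifting every label by one turns it into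
-- addition mod n on {0, …, n - 1}.
infixl 6 _⊕_
_⊕_ : Fin n → ℕ → Fin n
_⊕_ {suc _} j i = (toℕ j ℕ.+ i) mod _

⊕-≢ : ∀ (j : Fin n) {i} → 1 ≤ i → i ℕ.< n → j ⊕ i ≢ j
⊕-≢ {n@(suc _)} j {i@(suc _)} _ i<n eq = >⇒∤ i<n (divides q i≡q*n)
  where
  open ≡-Reasoning
  q = (toℕ j ℕ.+ i) / n
  i≡q*n : i ≡ q ℕ.* n
  i≡q*n = ℕ.+-cancelˡ-≡ (toℕ j) i (q ℕ.* n) (begin
    toℕ j ℕ.+ i                        ≡⟨ m≡m%n+[m/n]*n (toℕ j ℕ.+ i) n ⟩
    (toℕ j ℕ.+ i) % n ℕ.+ q ℕ.* n      ≡⟨ cong (ℕ._+ q ℕ.* n) (Fin.toℕ-fromℕ< _) ⟨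
    toℕ (j ⊕ i) ℕ.+ q ℕ.* n            ≡⟨ cong (λ v → toℕ v ℕ.+ q ℕ.* n) eq ⟩
    toℕ j ℕ.+ q ℕ.* n                  ∎)

circulant : (n : ℕ) → ConnectionSet n → Graph n
circulant n S = record
  { Adj        = Adj
  ; adj?       = λ u v → any? (λ i → (u ⊕ i Fin.≟ v) ⊎-dec (v ⊕ i Fin.≟ u)) elements
  ; adj-sym    = Any.map swap
  ; adj-irrefl = λ { refl → irrefl }
  }
  where
  open ConnectionSet S

  Adj : Rel (Fin n) 0ℓ
  Adj u v = Any (λ i → u ⊕ i ≡ v ⊎ v ⊕ i ≡ u) elements

  noLoop : ∀ (u : Fin n) {i} → 1 ≤ i × i ≤ ⌊ n /2⌋ → ¬ (u ⊕ i ≡ u ⊎ u ⊕ i ≡ u)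
  noLoop u@zero    (1≤i , i≤) = [ p , p ]′ where p = ⊕-≢ u 1≤i (ℕ.≤-<-trans i≤ (ℕ.⌊n/2⌋<n _))
  noLoop u@(suc _) (1≤i , i≤) = [ p , p ]′ where p = ⊕-≢ u 1≤i (ℕ.≤-<-trans i≤ (ℕ.⌊n/2⌋<n _))

  irrefl : ∀ {u} → ¬ Adj u u
  irrefl {u} adj = All.lookupWith (λ b e → noLoop u b e) bounded adj

-- The cyclic order (ω 0, ω 1, …, ω (n - 1)); rotations of ω present the
-- same cyclic order.
CyclicOrder : ℕ → Set
CyclicOrder = Permutation′

-- The drawings use points with rational coordinates.  Two non-parallel
-- lines through such points meet in a rational point, so crossings are
-- the same as over the reals.
Point : Set
Point = ℚ × ℚ

OnUnitCircle : Point → Set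
OnUnitCircle (x , y) = x * x + y * y ≡ 1ℚ

Counterclockwise : Point → Point → Point → Set
Counterclockwise (x₁ , y₁) (x₂ , y₂) (x₃ , y₃) =
  0ℚ ℚ.< (x₂ - x₁) * (y₃ - y₁) - (y₂ - y₁) * (x₃ - x₁)

OnSegment : Point → Point → Point → Set
OnSegment (x₁ , y₁) (x₂ , y₂) (x , y) =
  ∃[ t ] 0ℚ ℚ.≤ t × t ℚ.≤ 1ℚ
    × x ≡ (1ℚ - t) * x₁ + t * x₂
    × y ≡ (1ℚ - t) * y₁ + t * y₂

record Drawing (ω : CyclicOrder n) : Set where
  field
    point    : Fin n → Point
    onCircle : ∀ u → OnUnitCircle (point u)
    inOrder  : ∀ {i j k} → i Fin.< j → j Fin.< k →
               Counterclockwise (point (ω ⟨$⟩ʳ i)) (point (ω ⟨$⟩ʳ j)) (point (ω ⟨$⟩ʳ k))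

  Cross : (u v w x : Fin n) → Set
  Cross u v w x = ∃[ P ]
      OnSegment (point u) (point v) P
    × OnSegment (point w) (point x) P
    × All (P ≢_) (point u ∷ point v ∷ point w ∷ point x ∷ [])

SameEdge : (u v w x : Fin n) → Set
SameEdge u v w x = (u ≡ w × v ≡ x) ⊎ (u ≡ x × v ≡ w)

ShareEndpoint : (u v w x : Fin n) → Set
ShareEndpoint u v w x = (u ≡ w ⊎ u ≡ x) ⊎ (v ≡ w ⊎ v ≡ x)

-- c i u v: the edge u-v has colour i.
Colouring : ℕ → ℕ → Set₁
Colouring n k = Fin k → Rel (Fin n) 0ℓ

-- The last field makes k the number of colours, not just a bound on it.
record IsEdgeColouring (G : Graph n) (c : Colouring n k) : Set where
  open Graph G
  field
    onEdges    : ∀ {i u v} → c i u v → Adj u v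
    undirected : ∀ {i u v} → c i u v → c i v u
    total      : ∀ {u v} → Adj u v → ∃[ i ] c i u v
    unique     : ∀ {i j u v} → c i u v → c j u v → i ≡ j
    allUsed    : ∀ i → ∃₂ λ u v → c i u v

record IsMatchingBookEmbedding (G : Graph n) (ω : CyclicOrder n) (c : Colouring n k) : Set where
  field
    isEdgeColouring : IsEdgeColouring G c
    noCrossing      : (D : Drawing ω) → ∀ {i u v w x} → c i u v → c i w x →
                      ¬ SameEdge u v w x → ¬ Drawing.Cross D u v w x
    isMatching      : ∀ {i u v w x} → c i u v → c i w x →
                      ¬ SameEdge u v w x → ¬ ShareEndpoint u v w x

record IsDispersableMatchingBookEmbedding (G : Graph n) (ω : CyclicOrder n) (c : Colouring n k) : Set where
  field
    isMatchingBookEmbedding : IsMatchingBookEmbedding G ω c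
    pages≡maxDegree         : k ≡ Graph.maxDegree G

C[_,⟨1,3⟩] : (n : ℕ) → 8 ≤ n → Graph n
C[ n ,⟨1,3⟩] 8≤n = circulant n record
  { first      = 1
  ; rest       = 3 ∷ []
  ; increasing = s≤s (s≤s z≤n) ∷ [-]
  ; bounded    = (s≤s z≤n , ℕ.≤-trans (ℕ.m≤m+n 1 3) 4≤) ∷ (s≤s z≤n , ℕ.≤-trans (ℕ.m≤m+n 3 1) 4≤) ∷ []
  }
  where
  4≤ : 4 ≤ ⌊ n /2⌋
  4≤ = ℕ.⌊n/2⌋-mono 8≤n

-- (1, 2, 3, n, n - 1, …, 5, 4); the last clause is never used for n ≥ 8.
τ : (n : ℕ) → CyclicOrder n
τ (suc (suc (suc m))) = lift₀ (lift₀ (lift₀ reverse))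
τ _                   = Perm.id

_ : map (λ i → label (τ 8 ⟨$⟩ʳ i)) (allFin 8) ≡ 1 ∷ 2 ∷ 3 ∷ 8 ∷ 7 ∷ 6 ∷ 5 ∷ 4 ∷ []
_ = refl

pattern red    = 0F
pattern blue   = 1F
pattern green  = 2F
pattern purple = 3F

infix 6 _—_
_—_ : ℕ → ℕ → ℕ × ℕ
u — v = u , v

twist : ℕ → Fin 4 → List (ℕ × ℕ)
twist n red    = 1 — 2 ∷ 3 — 4 ∷ []
twist n blue   = 2 — 3 ∷ 1 — n ∷ []
twist n green  = 3 — n ∷ 2 — (n ∸ 1) ∷ 1 — (n ∸ 2) ∷ []
twist n purple = 1 — 4 ∷ 2 — 5 ∷ 3 — 6 ∷ []

-- The edges a-(a+3) and (a+1)-(a+2) for a = r + 4t, t ∈ [m].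
nested : (r m : ℕ) → List (ℕ × ℕ)
nested r m = concatMap (λ a → a — (a ℕ.+ 3) ∷ (a ℕ.+ 1) — (a ℕ.+ 2) ∷ [])
                       (applyUpTo (λ t → r ℕ.+ 4 ℕ.* suc t) m)

remaining-4k : (n k : ℕ) → Fin 4 → List (ℕ × ℕ)
remaining-4k n k blue   = nested 0 (k ∸ 1)
remaining-4k n k red    = nested 1 (k ∸ 1)
remaining-4k n k green  = nested 2 (k ∸ 2) ++ 4 — 5 ∷ []
remaining-4k n k purple = nested 3 (k ∸ 2) ++ (n ∸ 1) — n ∷ []

remaining-4k+2 : (n k : ℕ) → Fin 4 → List (ℕ × ℕ)
remaining-4k+2 n k green  = nested 0 (k ∸ 1)
remaining-4k+2 n k red    = nested 1 (k ∸ 1) ++ (n ∸ 1) — n ∷ []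
remaining-4k+2 n k blue   = nested 2 (k ∸ 1) ++ 4 — 5 ∷ []
remaining-4k+2 n k purple = nested 3 (k ∸ 1)

data HasColour (n : ℕ) (i : Fin 4) (e : ℕ × ℕ) : Set where
  inTwist : e ∈ twist n i → HasColour n i e
  in-4k   : ∀ k → n ≡ 4 ℕ.* k → e ∈ remaining-4k n k i → HasColour n i e
  in-4k+2 : ∀ k → n ≡ 4 ℕ.* k ℕ.+ 2 → e ∈ remaining-4k+2 n k i → HasColour n i e

colouring : (n : ℕ) → Colouring n 4
colouring n i u v = HasColour n i (label u — label v) ⊎ HasColour n i (label v — label u)

-- Every cyclic order has a drawing, so quantifying over all drawings in
-- noCrossing is never vacuous.  The i-th point has polar angle 2 arctan i.
private
  param : ℕ → ℚ
  param zero    = 0ℚ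
  param (suc i) = param i + 1ℚ

  param-< : ∀ {i j} → i ℕ.< j → param i ℚ.< param j
  param-< {i} i<j = go (ℕ.≤⇒≤′ i<j)
    where
    step : ∀ p → p ℚ.< p + 1ℚ
    step p = subst (ℚ._< p + 1ℚ) (ℚ.+-identityʳ p) (ℚ.+-monoʳ-< p (ℚ.positive⁻¹ 1ℚ))
    go : ∀ {j} → suc i ℕ.≤′ j → param i ℚ.< param j
    go ℕ.≤′-refl     = step _
    go (ℕ.≤′-step p) = ℚ.<-trans (go p) (step _)

  0<1+p² : ∀ p → 0ℚ ℚ.< 1ℚ + p * p
  0<1+p² p = ℚ.<-≤-trans (ℚ.positive⁻¹ 1ℚ)
    (subst (ℚ._≤ 1ℚ + p * p) (ℚ.+-identityʳ 1ℚ) (ℚ.+-monoʳ-≤ 1ℚ 0≤p²))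
    where
    0≤p² : 0ℚ ℚ.≤ p * p
    0≤p² with ℚ.≤-total 0ℚ p
    ... | inj₁ 0≤p = ℚ.nonNegative⁻¹ (p * p) {{ℚ.nonNeg*nonNeg⇒nonNeg p {{ℚ.nonNegative 0≤p}} p {{ℚ.nonNegative 0≤p}}}}
    ... | inj₂ p≤0 = ℚ.nonNegative⁻¹ (p * p) {{ℚ.nonPos*nonPos⇒nonPos p {{ℚ.nonPositive p≤0}} p {{ℚ.nonPositive p≤0}}}}

  module _ (p : ℚ) where
    private instance
      pos : Positive (1ℚ + p * p)
      pos = ℚ.positive (0<1+p² p)
      nz : ℚ.NonZero (1ℚ + p * p)
      nz = ℚ.pos⇒nonZero (1ℚ + p * p)

    inv : ℚ
    inv = 1/ (1ℚ + p * p)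

    inv-pos : Positive inv
    inv-pos = ℚ.1/pos⇒pos (1ℚ + p * p)

    weight : ℚ
    weight = inv * (1ℚ + p * p)

    weight≡1 : weight ≡ 1ℚ
    weight≡1 = ℚ.*-inverseˡ (1ℚ + p * p)

  circlePoint : ℚ → Point
  circlePoint p = inv p * (1ℚ - p * p) , inv p * (p + p)

  circlePoint-on : ∀ p → OnUnitCircle (circlePoint p)
  circlePoint-on p = trans (identity p (inv p)) (cong (λ w → w * w) (weight≡1 p))
    where
    open +-*-Solver
    identity : ∀ p q → q * (1ℚ - p * p) * (q * (1ℚ - p * p)) + q * (p + p) * (q * (p + p))
                     ≡ q * (1ℚ + p * p) * (q * (1ℚ + p * p))
    identity = solve 2 (λ p q →
      q :* (con 1ℚ :- p :* p) :* (q :* (con 1ℚ :- p :* p)) :+ q :* (p :+ p) :* (q :* (p :+ p))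
      := q :* (con 1ℚ :+ p :* p) :* (q :* (con 1ℚ :+ p :* p))) refl

  det : (w₁ w₂ w₃ : ℚ) → Point → Point → Point → ℚ
  det w₁ w₂ w₃ (x₁ , y₁) (x₂ , y₂) (x₃ , y₃) =
    (x₂ * w₁ - x₁ * w₂) * (y₃ * w₁ - y₁ * w₃) - (y₂ * w₁ - y₁ * w₂) * (x₃ * w₁ - x₁ * w₃)

  circlePoint-ccw : ∀ {p q r} → p ℚ.< q → q ℚ.< r →
                    Counterclockwise (circlePoint p) (circlePoint q) (circlePoint r)
  circlePoint-ccw {p} {q} {r} p<q q<r =
    subst (0ℚ ℚ.<_) eq (ℚ.positive⁻¹ (proj₁ prod) {{proj₂ prod}})
    where
    open +-*-Solver
    diff : ∀ {a b} → a ℚ.< b → Positive (b - a)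
    diff {a} {b} a<b = ℚ.positive (subst (ℚ._< b - a) (ℚ.+-inverseʳ a) (ℚ.+-monoˡ-< (- a) a<b))
    infixl 7 _⊗_
    _⊗_ : ∃[ a ] Positive a → ∃[ a ] Positive a → ∃[ a ] Positive a
    (a , pa) ⊗ (b , pb) = a * b , ℚ.pos*pos⇒pos a {{pa}} b {{pb}}

    double : ∃[ a ] Positive a → ∃[ a ] Positive a
    double (a , pa) = a + a , ℚ.pos+pos⇒pos a {{pa}} a {{pa}}

    prod : ∃[ a ] Positive a
    prod = (weight p , subst Positive (sym (weight≡1 p)) (ℚ.positive (ℚ.positive⁻¹ 1ℚ)))
      ⊗ ((inv p , inv-pos p) ⊗ (inv q , inv-pos q) ⊗ (inv r , inv-pos r)
      ⊗ (double (q - p , diff p<q) ⊗ double (r - p , diff (ℚ.<-trans p<q q<r)) ⊗ (r - q , diff q<r)))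

    identity : ∀ p q r a b c →
      a * (1ℚ + p * p) * (a * b * c * ((q - p + (q - p)) * (r - p + (r - p)) * (r - q)))
      ≡ det (a * (1ℚ + p * p)) (b * (1ℚ + q * q)) (c * (1ℚ + r * r))
            (a * (1ℚ - p * p) , a * (p + p)) (b * (1ℚ - q * q) , b * (q + q)) (c * (1ℚ - r * r) , c * (r + r))
    identity = solve 6 (λ p q r a b c →
      let W : _ → _ → _
          W a p = a :* (con 1ℚ :+ p :* p)
          X : _ → _ → _
          X a p = a :* (con 1ℚ :- p :* p)
          Y : _ → _ → _
          Y a p = a :* (p :+ p)
      in
      a :* (con 1ℚ :+ p :* p) :* (a :* b :* c :* ((q :- p :+ (q :- p)) :* (r :- p :+ (r :- p)) :* (r :- q)))
      := (X b q :* W a p :- X a p :* W b q) :* (Y c r :* W a p :- Y a p :* W c r)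
         :- (Y b q :* W a p :- Y a p :* W b q) :* (X c r :* W a p :- X a p :* W c r)) refl

    det-1 : ∀ {w₁ w₂ w₃} x₁ y₁ x₂ y₂ x₃ y₃ → w₁ ≡ 1ℚ → w₂ ≡ 1ℚ → w₃ ≡ 1ℚ →
      det w₁ w₂ w₃ (x₁ , y₁) (x₂ , y₂) (x₃ , y₃)
      ≡ (x₂ - x₁) * (y₃ - y₁) - (y₂ - y₁) * (x₃ - x₁)
    det-1 x₁ y₁ x₂ y₂ x₃ y₃ refl refl refl
      rewrite ℚ.*-identityʳ x₁ | ℚ.*-identityʳ y₁ | ℚ.*-identityʳ x₂
            | ℚ.*-identityʳ y₂ | ℚ.*-identityʳ x₃ | ℚ.*-identityʳ y₃ = refl

    eq = trans (identity p q r (inv p) (inv q) (inv r))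
               (det-1 (proj₁ (circlePoint p)) (proj₂ (circlePoint p))
                      (proj₁ (circlePoint q)) (proj₂ (circlePoint q))
                      (proj₁ (circlePoint r)) (proj₂ (circlePoint r))
                      (weight≡1 p) (weight≡1 q) (weight≡1 r))

drawing : (ω : CyclicOrder n) → Drawing ω
drawing ω = record
  { point    = λ u → at (ω ⟨$⟩ˡ u)
  ; onCircle = λ u → circlePoint-on (param (toℕ (ω ⟨$⟩ˡ u)))
  ; inOrder  = λ i<j j<k → ccw i<j j<k
  }
  where
  at : Fin _ → Point
  at i = circlePoint (param (toℕ i))

  ccw : ∀ {i j k} → i Fin.< j → j Fin.< k →
    Counterclockwise (at (ω ⟨$⟩ˡ (ω ⟨$⟩ʳ i))) (at (ω ⟨$⟩ˡ (ω ⟨$⟩ʳ j))) (at (ω ⟨$⟩ˡ (ω ⟨$⟩ʳ k)))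
  ccw {i} {j} {k} i<j j<k
    rewrite inverseˡ ω {i} | inverseˡ ω {j} | inverseˡ ω {k} =
    circlePoint-ccw {param (toℕ i)} {param (toℕ j)} {param (toℕ k)} (param-< i<j) (param-< j<k)

{-# OPTIONS --safe #-}
-- Read backwards from the vertex 4, the cyclic order is 4, 5, …, n, 3, 2, 1,
-- and in this linear order each page is built from single arcs by nesting
-- and juxtaposition.  Distinct edges of such a page have disjoint ends, with
-- both ends of one strictly on one side of the other, so convexity of the
-- circle keeps the chords apart.
module Submission where

open import Defs
open import Data.Nat using (ℕ; _≤_)
open import Data.Nat.Divisibility using (_∣_)

open import Data.Bool using (if_then_else_)
open import Data.Empty using (⊥)
open import Data.Fin as Fin using (Fin; zero; suc; toℕ; opposite)
open import Data.Fin.Patterns using (0F; 1F; 2F; 3F; 4F; 6F)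
open import Data.Fin.Permutation using (_⟨$⟩ʳ_; _⟨$⟩ˡ_; inverseʳ)
import Data.Fin.Properties as Fin
open import Data.List using (List; []; _∷_; _++_; length; lookup; allFin; map; concatMap; applyUpTo)
open import Data.List.Extrema.Nat using (max≈v⁺)
open import Data.List.Membership.Propositional using (_∈_; find)
open import Data.List.Membership.Propositional.Properties
open import Data.List.Relation.Binary.Subset.Propositional using (_⊆_)
open import Data.List.Relation.Unary.All using ([]; _∷_)
import Data.List.Relation.Unary.All as All
import Data.List.Relation.Unary.All.Properties as All
open import Data.List.Relation.Unary.AllPairs using ([]; _∷_)
open import Data.List.Relation.Unary.Any using (here; there; index)
import Data.List.Relation.Unary.Any as Any
open import Data.List.Relation.Unary.Any.Properties using (lookup-index)
open import Data.List.Relation.Unary.Unique.Propositional using (Unique)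
open import Data.List.Relation.Unary.Unique.Propositional.Properties using (allFin⁺; filter⁺)
open import Data.Nat using (zero; suc; _+_; _*_; _∸_; _<_; z≤n; s≤s)
open import Data.Nat.DivMod using (_%_; m<n⇒m%n≡m; [m+n]%n≡m%n; m≤n⇒[n∸m]%m≡n%m; _divMod_; result)
open import Data.Nat.Divisibility using (divides)
import Data.Nat.Properties as ℕ
open import Data.Nat.Tactic.RingSolver using (solve-∀)
open import Data.Product using (_×_; _,_; proj₁; proj₂; ∃-syntax; ∃₂) renaming (swap to ×-swap)
open import Data.Rational as ℚ using (ℚ; 0ℚ; 1ℚ)
import Data.Rational.Properties as ℚ
open import Data.Rational.Solver using (module +-*-Solver)
open import Data.Sum using (_⊎_; inj₁; inj₂; swap; [_,_]′)
open import Function using (_∘_; id)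
open import Relation.Binary.PropositionalEquality
open import Relation.Nullary using (¬_; yes; no; does; contradiction)
open import Relation.Nullary.Decidable using (dec-true; dec-false)

-- Every vertex of C(n,{1,3}) has degree four, so four pages that are matchings must all be perfect
-- matchings. Hence the arcs of a page tile the places 4, ..., n + 3 without gaps. `Planar` carries
-- its interval as an index, and these indices keep the arcs apart, with no comparison of edges.
--
-- The twist edges are exactly those that meet 1, 2 or 3. A page with two of them leaves n - 4
-- places free, a page with three leaves n - 6. Nested pairs fill these four at a time; where the
-- rest is 2 mod 4, one of the edges 4-5 and (n - 1)-n makes up the difference. This is why these
-- two edges change pages with n mod 4. The colour of a nested pair depends only on its first label
-- mod 4, so both cases are instances of one description, `Edge`, given by a periodic function and
-- two further colours, and the properties of the colouring are proved once for it.
--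
-- That no edge has two colours is not shown by comparing the lists: one function, `colourOf`,
-- recovers the colour from the two labels.

-- Orientation and segments in the plane.

rotate-ccw : ∀ p q r → Counterclockwise p q r → Counterclockwise q r p
rotate-ccw (x₁ , y₁) (x₂ , y₂) (x₃ , y₃) = subst (0ℚ ℚ.<_) (identity x₁ y₁ x₂ y₂ x₃ y₃)
  where
  open +-*-Solver
  identity : ∀ x₁ y₁ x₂ y₂ x₃ y₃ →
    (x₂ ℚ.- x₁) ℚ.* (y₃ ℚ.- y₁) ℚ.- (y₂ ℚ.- y₁) ℚ.* (x₃ ℚ.- x₁) ≡
    (x₃ ℚ.- x₂) ℚ.* (y₁ ℚ.- y₂) ℚ.- (y₃ ℚ.- y₂) ℚ.* (x₁ ℚ.- x₂)
  identity = solve 6 (λ x₁ y₁ x₂ y₂ x₃ y₃ →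
    (x₂ :- x₁) :* (y₃ :- y₁) :- (y₂ :- y₁) :* (x₃ :- x₁) :=
    (x₃ :- x₂) :* (y₁ :- y₂) :- (y₃ :- y₂) :* (x₁ :- x₂)) refl

p≤q⇒0≤q-p : ∀ {p q} → p ℚ.≤ q → 0ℚ ℚ.≤ q ℚ.- p
p≤q⇒0≤q-p {p} {q} p≤q = subst (ℚ._≤ q ℚ.- p) (ℚ.+-inverseʳ p) (ℚ.+-monoˡ-≤ (ℚ.- p) p≤q)

segment-swap : ∀ {p q r} → OnSegment p q r → OnSegment q p r
segment-swap {x₁ , y₁} {x₂ , y₂} (t , 0≤t , t≤1 , x≡ , y≡) =
  1ℚ ℚ.- t , p≤q⇒0≤q-p t≤1 , 1-t≤1 , trans x≡ (identity t x₁ x₂) , trans y≡ (identity t y₁ y₂)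
  where
  open +-*-Solver
  identity : ∀ t a b → (1ℚ ℚ.- t) ℚ.* a ℚ.+ t ℚ.* b ≡ (1ℚ ℚ.- (1ℚ ℚ.- t)) ℚ.* b ℚ.+ (1ℚ ℚ.- t) ℚ.* a
  identity = solve 3 (λ t a b →
    (con 1ℚ :- t) :* a :+ t :* b := (con 1ℚ :- (con 1ℚ :- t)) :* b :+ (con 1ℚ :- t) :* a) refl
  1-t≤1 : 1ℚ ℚ.- t ℚ.≤ 1ℚ
  1-t≤1 = subst (1ℚ ℚ.- t ℚ.≤_) (ℚ.+-identityʳ 1ℚ) (ℚ.+-monoʳ-≤ 1ℚ (ℚ.neg-antimono-≤ 0≤t))

convex-pos : ∀ t {a b} → 0ℚ ℚ.≤ t → t ℚ.≤ 1ℚ → 0ℚ ℚ.< a → 0ℚ ℚ.< b →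
             0ℚ ℚ.< (1ℚ ℚ.- t) ℚ.* a ℚ.+ t ℚ.* b
-- The weights 1 - t and t are never both zero: at t = 0 the first term is a itself, and otherwise
-- the second term is positive.
convex-pos t {a} {b} 0≤t t≤1 0<a 0<b with t ℚ.≤? 0ℚ
... | yes t≤0 rewrite ℚ.≤-antisym t≤0 0≤t | ℚ.*-identityˡ a | ℚ.*-zeroˡ b | ℚ.+-identityʳ a = 0<a
... | no  t≰0 = ℚ.+-mono-≤-< {0ℚ} {(1ℚ ℚ.- t) ℚ.* a} {0ℚ} {t ℚ.* b} 0≤[1-t]a 0<tb
  where
  instance
    _ = ℚ.nonNegative (p≤q⇒0≤q-p t≤1)
    _ = ℚ.nonNegative (ℚ.<⇒≤ 0<a)
    _ = ℚ.positive (ℚ.≰⇒> t≰0)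
    _ = ℚ.positive 0<b
  0≤[1-t]a : 0ℚ ℚ.≤ (1ℚ ℚ.- t) ℚ.* a
  0≤[1-t]a = ℚ.nonNegative⁻¹ ((1ℚ ℚ.- t) ℚ.* a) {{ℚ.nonNeg*nonNeg⇒nonNeg (1ℚ ℚ.- t) a}}
  0<tb : 0ℚ ℚ.< t ℚ.* b
  0<tb = ℚ.positive⁻¹ (t ℚ.* b) {{ℚ.pos*pos⇒pos t b}}

-- The orientation determinant of p, q and a varying point is affine, and
-- it vanishes on pq.
sameSide⇒disjoint : ∀ p q r s {z} → Counterclockwise p q r → Counterclockwise p q s →
                    OnSegment p q z → OnSegment r s z → ⊥
sameSide⇒disjoint (x₁ , y₁) (x₂ , y₂) (x₃ , y₃) (x₄ , y₄) r-left s-left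
                  (t , _ , _ , refl , refl) (t′ , 0≤t′ , t′≤1 , x≡ , y≡) =
  ℚ.<-irrefl (sym vanishes) (convex-pos t′ 0≤t′ t′≤1 r-left s-left)
  where
  open +-*-Solver
  det : (x y : ℚ) → ℚ
  det x y = (x₂ ℚ.- x₁) ℚ.* (y ℚ.- y₁) ℚ.- (y₂ ℚ.- y₁) ℚ.* (x ℚ.- x₁)
  vanishes : (1ℚ ℚ.- t′) ℚ.* det x₃ y₃ ℚ.+ t′ ℚ.* det x₄ y₄ ≡ 0ℚ
  vanishes = begin
    (1ℚ ℚ.- t′) ℚ.* det x₃ y₃ ℚ.+ t′ ℚ.* det x₄ y₄
      ≡⟨ solve 9 (λ t x₁ y₁ x₂ y₂ x₃ y₃ x₄ y₄ →
           let d : _ → _ → _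
               d x y = (x₂ :- x₁) :* (y :- y₁) :- (y₂ :- y₁) :* (x :- x₁)
           in (con 1ℚ :- t) :* d x₃ y₃ :+ t :* d x₄ y₄ :=
              d ((con 1ℚ :- t) :* x₃ :+ t :* x₄) ((con 1ℚ :- t) :* y₃ :+ t :* y₄))
           refl t′ x₁ y₁ x₂ y₂ x₃ y₃ x₄ y₄ ⟩
    det ((1ℚ ℚ.- t′) ℚ.* x₃ ℚ.+ t′ ℚ.* x₄) ((1ℚ ℚ.- t′) ℚ.* y₃ ℚ.+ t′ ℚ.* y₄)
      ≡⟨ cong₂ det x≡ y≡ ⟨
    det ((1ℚ ℚ.- t) ℚ.* x₁ ℚ.+ t ℚ.* x₂) ((1ℚ ℚ.- t) ℚ.* y₁ ℚ.+ t ℚ.* y₂)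
      ≡⟨ solve 5 (λ t x₁ y₁ x₂ y₂ →
           (x₂ :- x₁) :* ((con 1ℚ :- t) :* y₁ :+ t :* y₂ :- y₁)
           :- (y₂ :- y₁) :* ((con 1ℚ :- t) :* x₁ :+ t :* x₂ :- x₁) := con 0ℚ)
           refl t x₁ y₁ x₂ y₂ ⟩
    0ℚ ∎
    where open ≡-Reasoning

-- The cyclic order as a linear order of places.

-- The place of the vertex ℓ in 4, 5, …, n, 3, 2, 1, counted from 4.
place : ℕ → ℕ → ℕ
place n 1 = 3 + n
place n 2 = 2 + n
place n 3 = 1 + n
place n ℓ = ℓ

place-≥4 : ∀ n {ℓ} → 4 ≤ ℓ → place n ℓ ≡ ℓ
place-≥4 n (s≤s (s≤s (s≤s (s≤s _)))) = refl

-- Positions and places run through the vertices in opposite directions: the vertex 1 has position 0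
-- and the highest place, n + 3. Stated as a sum, the relation turns an inequality of places into
-- the reverse inequality of positions by cancellation.
τ-place : ∀ m (u : Fin (3 + m)) → toℕ (τ (3 + m) ⟨$⟩ˡ u) + place (3 + m) (label u) ≡ 6 + m
τ-place m zero                = refl
τ-place m (suc zero)          = refl
τ-place m (suc (suc zero))    = refl
τ-place m (suc (suc (suc i))) = cong (3 +_) (begin
  toℕ (opposite i) + (4 + toℕ i)       ≡⟨ cong (_+ (4 + toℕ i)) (Fin.opposite-prop i) ⟩
  (m ∸ suc (toℕ i)) + (3 + suc (toℕ i))  ≡⟨ cong (m ∸ suc (toℕ i) +_) (ℕ.+-comm 3 _) ⟩
  (m ∸ suc (toℕ i)) + (suc (toℕ i) + 3)  ≡⟨ ℕ.+-assoc (m ∸ suc (toℕ i)) _ 3 ⟨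
  (m ∸ suc (toℕ i)) + suc (toℕ i) + 3  ≡⟨ cong (_+ 3) (ℕ.m∸n+n≡m (Fin.toℕ<n i)) ⟩
  m + 3                                ≡⟨ ℕ.+-comm m 3 ⟩
  3 + m                                ∎)
  where open ≡-Reasoning

-- Noncrossing arcs in a linear order.

module _ (κ : ℕ → ℕ) where

  -- Edges are listed with the smaller label first, but `place` does not respect labels: in 3-4 the
  -- end 4 is the lower one.
  Joins : ℕ × ℕ → ℕ → ℕ → Set
  Joins (a , b) l h = (κ a ≡ l × κ b ≡ h) ⊎ (κ a ≡ h × κ b ≡ l)

  -- The places are those of a half-open interval: l, …, h - 1.
  data Planar : ℕ → ℕ → List (ℕ × ℕ) → Set where
    []  : ∀ {l} → Planar l l []
    arc : ∀ {e l h es} → Joins e l h → Planar (suc l) h es → Planar l (suc h) (e ∷ es)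
    _⋆_ : ∀ {l m h es fs} → Planar l m es → Planar m h fs → Planar l h (es ++ fs)

  infixr 5 _⋆_

  data Apart (e f : ℕ × ℕ) : Set where
    around : ∀ {l l′ h′ h} → Joins e l h → Joins f l′ h′ → l < l′ → l′ < h′ → h′ < h → Apart e f
    before : ∀ {l h l′ h′} → Joins e l h → Joins f l′ h′ → l < h → h < l′ → l′ < h′ → Apart e f

  joins-swap : ∀ {a b l h} → Joins (a , b) l h → Joins (b , a) l h
  joins-swap (inj₁ (p , q)) = inj₂ (q , p)
  joins-swap (inj₂ (p , q)) = inj₁ (q , p)

  apart-swapˡ : ∀ {a b f} → Apart (a , b) f → Apart (b , a) f
  apart-swapˡ (around e f p q r) = around (joins-swap e) f p q r
  apart-swapˡ (before e f p q r) = before (joins-swap e) f p q r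

  apart-swapʳ : ∀ {e a b} → Apart e (a , b) → Apart e (b , a)
  apart-swapʳ (around e f p q r) = around e (joins-swap f) p q r
  apart-swapʳ (before e f p q r) = before e (joins-swap f) p q r

  planar⇒≤ : ∀ {l h es} → Planar l h es → l ≤ h
  planar⇒≤ []        = ℕ.≤-refl
  planar⇒≤ (arc _ p) = ℕ.<⇒≤ (ℕ.m≤n⇒m≤1+n (planar⇒≤ p))
  planar⇒≤ (p ⋆ q)   = ℕ.≤-trans (planar⇒≤ p) (planar⇒≤ q)

  planar-within : ∀ {l h es e} → Planar l h es → e ∈ es →
                  ∃[ l′ ] ∃[ h′ ] Joins e l′ h′ × l ≤ l′ × l′ < h′ × h′ < h
  planar-within (arc j p) (here refl) = _ , _ , j , ℕ.≤-refl , planar⇒≤ p , ℕ.≤-refl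
  planar-within (arc _ p) (there e∈) with planar-within p e∈
  ... | _ , _ , j , l<l′ , l′<h′ , h′<h = _ , _ , j , ℕ.<⇒≤ l<l′ , l′<h′ , ℕ.m≤n⇒m≤1+n h′<h
  planar-within (_⋆_ {es = es} p q) e∈ with ∈-++⁻ es e∈
  ... | inj₁ e∈ˡ with planar-within p e∈ˡ
  ...   | _ , _ , j , l≤l′ , l′<h′ , h′<m = _ , _ , j , l≤l′ , l′<h′ , ℕ.<-≤-trans h′<m (planar⇒≤ q)
  planar-within (p ⋆ q) e∈ | inj₂ e∈ʳ with planar-within q e∈ʳ
  ...   | _ , _ , j , m≤l′ , l′<h′ , h′<h = _ , _ , j , ℕ.≤-trans (planar⇒≤ p) m≤l′ , l′<h′ , h′<h

  arc-apart : ∀ {l h es e f} → Joins e l h → Planar (suc l) h es → f ∈ es → Apart e f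
  arc-apart j p f∈ with planar-within p f∈
  ... | _ , _ , j′ , l<l′ , l′<h′ , h′<h = around j j′ l<l′ l′<h′ h′<h

  ⋆-apart : ∀ {l m h es fs e f} → Planar l m es → Planar m h fs → e ∈ es → f ∈ fs → Apart e f
  ⋆-apart p q e∈ f∈ with planar-within p e∈ | planar-within q f∈
  ... | _ , _ , j , _ , l<h , h<m | _ , _ , j′ , m≤l′ , l′<h′ , _ = before j j′ l<h (ℕ.<-≤-trans h<m m≤l′) l′<h′

  -- Induction down to the constructor that separates the two edges: `arc` puts one around the
  -- other, `⋆` puts one before the other. `Apart` is not symmetric, hence its two orders.
  planar-apart : ∀ {l h es e f} → Planar l h es → e ∈ es → f ∈ es → e ≡ f ⊎ Apart e f ⊎ Apart f e
  planar-apart (arc _ _) (here refl) (here refl) = inj₁ refl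
  planar-apart (arc j p) (here refl) (there f∈)  = inj₂ (inj₁ (arc-apart j p f∈))
  planar-apart (arc j p) (there e∈)  (here refl) = inj₂ (inj₂ (arc-apart j p e∈))
  planar-apart (arc _ p) (there e∈)  (there f∈)  = planar-apart p e∈ f∈
  planar-apart (_⋆_ {es = es} p q) e∈ f∈ with ∈-++⁻ es e∈ | ∈-++⁻ es f∈
  ... | inj₁ e∈ˡ | inj₁ f∈ˡ = planar-apart p e∈ˡ f∈ˡ
  ... | inj₁ e∈ˡ | inj₂ f∈ʳ = inj₂ (inj₁ (⋆-apart p q e∈ˡ f∈ʳ))
  ... | inj₂ e∈ʳ | inj₁ f∈ˡ = inj₂ (inj₂ (⋆-apart p q f∈ˡ e∈ʳ))
  ... | inj₂ e∈ʳ | inj₂ f∈ʳ = planar-apart q e∈ʳ f∈ʳ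

  -- The common consequence of both forms of `Apart`, with the first edge as separator. The strict
  -- inequalities exclude shared ends and fix the orientation of c and d against the chord ab.
  data OneSide (a b c d : ℕ) : Set where
    between : ∀ {l h} → Joins (a , b) l h → l < κ c → κ c < h → l < κ d → κ d < h → OneSide a b c d
    beyond  : ∀ {l h} → Joins (a , b) l h → l < h → h < κ c → h < κ d → OneSide a b c d

  apart⇒oneSide : ∀ {a b c d} → Apart (a , b) (c , d) → OneSide a b c d
  apart⇒oneSide (around e (inj₁ (refl , refl)) p q r) = between e p (ℕ.<-trans q r) (ℕ.<-trans p q) r
  apart⇒oneSide (around e (inj₂ (refl , refl)) p q r) = between e (ℕ.<-trans p q) r p (ℕ.<-trans q r)
  apart⇒oneSide (before e (inj₁ (refl , refl)) p q r) = beyond e p q (ℕ.<-trans q r)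
  apart⇒oneSide (before e (inj₂ (refl , refl)) p q r) = beyond e p (ℕ.<-trans q r) q

  oneSide⇒≢ : ∀ {a b c d} → OneSide a b c d → (a ≢ c × a ≢ d) × (b ≢ c × b ≢ d)
  oneSide⇒≢ (between (inj₁ (refl , refl)) p q r s) =
    ((λ { refl → ℕ.<-irrefl refl p }) , λ { refl → ℕ.<-irrefl refl r }) ,
    ((λ { refl → ℕ.<-irrefl refl q }) , λ { refl → ℕ.<-irrefl refl s })
  oneSide⇒≢ (between (inj₂ (refl , refl)) p q r s) =
    ((λ { refl → ℕ.<-irrefl refl q }) , λ { refl → ℕ.<-irrefl refl s }) ,
    ((λ { refl → ℕ.<-irrefl refl p }) , λ { refl → ℕ.<-irrefl refl r })
  oneSide⇒≢ (beyond (inj₁ (refl , refl)) l<h p q) =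
    ((λ { refl → ℕ.<-asym l<h p }) , λ { refl → ℕ.<-asym l<h q }) ,
    ((λ { refl → ℕ.<-irrefl refl p }) , λ { refl → ℕ.<-irrefl refl q })
  oneSide⇒≢ (beyond (inj₂ (refl , refl)) l<h p q) =
    ((λ { refl → ℕ.<-irrefl refl p }) , λ { refl → ℕ.<-irrefl refl q }) ,
    ((λ { refl → ℕ.<-asym l<h p }) , λ { refl → ℕ.<-asym l<h q })

-- From places to chords of a drawing.

module _ (m : ℕ) (D : Drawing (τ (3 + m))) where
  open Drawing D

  private
    n = 3 + m

    height : Fin n → ℕ
    height u = place n (label u)

    position : Fin n → Fin n
    position u = τ n ⟨$⟩ˡ u

  position-anti : ∀ {u v} → height u < height v → position v Fin.< position u
  position-anti {u} {v} u<v = ℕ.+-cancelʳ-< (height v) (toℕ (position v)) (toℕ (position u))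
    (subst (_< toℕ (position u) + height v) (trans (τ-place m u) (sym (τ-place m v)))
           (ℕ.+-monoʳ-< (toℕ (position u)) u<v))

  -- Higher places come earlier in `τ`, and `inOrder` orients points by position in `τ`; hence the
  -- reversed order of the three points.
  place-ccw : ∀ {u v w} → height u < height v → height v < height w →
              Counterclockwise (point w) (point v) (point u)
  place-ccw {u} {v} {w} u<v v<w = subst₂ (λ w v → Counterclockwise (point w) (point v) (point u))
    (inverseʳ (τ n)) (inverseʳ (τ n))
    (subst (λ u′ → Counterclockwise (point (τ n ⟨$⟩ʳ position w)) (point (τ n ⟨$⟩ʳ position v)) (point u′))
      (inverseʳ (τ n)) (inOrder (position-anti {v} {w} v<w) (position-anti {u} {v} u<v)))

  -- Points between the ends lie to the left of the chord directed from its lower to its upper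
  -- place; points beyond lie to the left of the chord directed the other way, which is why that
  -- case swaps the segment. `rotate-ccw` brings the chord to the front of the triple.
  oneSide⇒disjoint : ∀ {u v w x P} → OneSide (place n) (label u) (label v) (label w) (label x) →
    OnSegment (point u) (point v) P → OnSegment (point w) (point x) P → ⊥
  oneSide⇒disjoint {u} {v} {w} {x} (between (inj₁ (refl , refl)) p q r s) uv wx =
    sameSide⇒disjoint (point u) (point v) (point w) (point x)
      (rotate-ccw (point w) (point u) (point v) (rotate-ccw (point v) (point w) (point u) (place-ccw {u} {w} {v} p q)))
      (rotate-ccw (point x) (point u) (point v) (rotate-ccw (point v) (point x) (point u) (place-ccw {u} {x} {v} r s)))
      uv wx
  oneSide⇒disjoint {u} {v} (between (inj₂ (refl , refl)) p q r s) uv =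
    oneSide⇒disjoint {v} {u} (between (inj₁ (refl , refl)) p q r s) (segment-swap uv)
  oneSide⇒disjoint {u} {v} {w} {x} (beyond (inj₁ (refl , refl)) l<h p q) uv wx =
    sameSide⇒disjoint (point v) (point u) (point w) (point x)
      (rotate-ccw (point w) (point v) (point u) (place-ccw {u} {v} {w} l<h p))
      (rotate-ccw (point x) (point v) (point u) (place-ccw {u} {v} {x} l<h q))
      (segment-swap uv) wx
  oneSide⇒disjoint {u} {v} (beyond (inj₂ (refl , refl)) l<h p q) uv =
    oneSide⇒disjoint {v} {u} (beyond (inj₁ (refl , refl)) l<h p q) (segment-swap uv)

-- Degrees and addition mod n.

-- Pigeonhole: sending an index of xs to an index of the same element in ys is injective, because xs
-- has no repetition.
⊆⇒length≤ : ∀ {A : Set} {xs ys : List A} → Unique xs → xs ⊆ ys → length xs ≤ length ys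
⊆⇒length≤ {xs = xs} {ys} xs! xs⊆ys = Fin.injective⇒≤ {f = λ i → index (xs⊆ys (∈-lookup i))}
  λ {i} {j} eq → lookup-injective xs! (begin
    lookup xs i                              ≡⟨ lookup-index (xs⊆ys (∈-lookup i)) ⟩
    lookup ys (index (xs⊆ys (∈-lookup i)))   ≡⟨ cong (lookup ys) eq ⟩
    lookup ys (index (xs⊆ys (∈-lookup j)))   ≡⟨ lookup-index (xs⊆ys (∈-lookup j)) ⟨
    lookup xs j                              ∎)
  where
  open ≡-Reasoning
  lookup-injective : ∀ {A : Set} {xs : List A} {i j} → Unique xs → lookup xs i ≡ lookup xs j → i ≡ j
  lookup-injective {xs = _ ∷ _} {zero}  {zero}  _         _  = refl
  lookup-injective {xs = _ ∷ _} {zero}  {suc j} (x∉ ∷ _)  eq = contradiction eq (All.lookup x∉ (∈-lookup j))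
  lookup-injective {xs = _ ∷ _} {suc i} {zero}  (x∉ ∷ _)  eq = contradiction (sym eq) (All.lookup x∉ (∈-lookup i))
  lookup-injective {xs = _ ∷ _} {suc i} {suc j} (_ ∷ xs!) eq = cong suc (lookup-injective xs! eq)

-- For variable n the filtered list in `degree` cannot be evaluated, so the maximum is squeezed: no
-- vertex has neighbours outside a list of length at most k, and u has at least k distinct ones.
maxDegree-≡ : ∀ {n} (G : Graph n) (nearby : Fin n → List (Fin n)) k u ns →
              (∀ v → length (nearby v) ≤ k) → (∀ {v w} → Graph.Adj G v w → w ∈ nearby v) →
              Unique ns → (∀ {w} → w ∈ ns → Graph.Adj G u w) → k ≤ length ns → Graph.maxDegree G ≡ k
maxDegree-≡ {n} G nearby k u ns nearby≤k adj⇒∈ ns! ∈⇒adj k≤ns =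
  max≈v⁺ (subst (_∈ map degree (allFin n)) (ℕ.≤-antisym (degree≤k u) k≤degree) (∈-map⁺ degree (∈-allFin u)))
         (All.map⁺ (All.universal degree≤k (allFin n))) z≤n
  where
  open Graph G
  degree≤k : ∀ v → degree v ≤ k
  degree≤k v = ℕ.≤-trans
    (⊆⇒length≤ (filter⁺ (adj? v) (allFin⁺ n)) (λ w∈ → adj⇒∈ (proj₂ (∈-filter⁻ (adj? v) {xs = allFin n} w∈))))
    (nearby≤k v)
  k≤degree : k ≤ degree u
  k≤degree = ℕ.≤-trans k≤ns (⊆⇒length≤ ns! (λ w∈ → ∈-filter⁺ (adj? u) (∈-allFin _) (∈⇒adj w∈)))

⊕-≡ : ∀ {n} (u v : Fin n) {i} → toℕ u + i ≡ toℕ v → u ⊕ i ≡ v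
⊕-≡ {suc _} u v {i} eq = Fin.toℕ-injective (begin
  toℕ (u ⊕ i)          ≡⟨ Fin.toℕ-fromℕ< _ ⟩
  (toℕ u + i) % suc _  ≡⟨ cong (_% suc _) eq ⟩
  toℕ v % suc _        ≡⟨ m<n⇒m%n≡m (Fin.toℕ<n v) ⟩
  toℕ v                ∎)
  where open ≡-Reasoning

⊕-≡-wrap : ∀ {n} (u v : Fin n) {i} → toℕ u + i ≡ toℕ v + n → u ⊕ i ≡ v
⊕-≡-wrap {n@(suc _)} u v {i} eq = Fin.toℕ-injective (begin
  toℕ (u ⊕ i)      ≡⟨ Fin.toℕ-fromℕ< _ ⟩
  (toℕ u + i) % n  ≡⟨ cong (_% n) eq ⟩
  (toℕ v + n) % n  ≡⟨ [m+n]%n≡m%n (toℕ v) n ⟩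
  toℕ v % n        ≡⟨ m<n⇒m%n≡m (Fin.toℕ<n v) ⟩
  toℕ v            ∎)
  where open ≡-Reasoning

-- Both summands are below n, so the reduction subtracts n at most once.
⊕-cases : ∀ {n} (u v : Fin n) {i} → i < n → u ⊕ i ≡ v →
          toℕ u + i ≡ toℕ v ⊎ toℕ u + i ≡ toℕ v + n
⊕-cases {n@(suc _)} u _ {i} i<n refl with toℕ u + i ℕ.<? n
... | yes u+i<n = inj₁ (sym (trans (Fin.toℕ-fromℕ< _) (m<n⇒m%n≡m u+i<n)))
... | no  u+i≮n = inj₂ (sym (begin
  toℕ (u ⊕ i) + n            ≡⟨ cong (_+ n) (Fin.toℕ-fromℕ< _) ⟩
  (toℕ u + i) % n + n        ≡⟨ cong (_+ n) (m≤n⇒[n∸m]%m≡n%m n≤u+i) ⟨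
  (toℕ u + i ∸ n) % n + n    ≡⟨ cong (_+ n) (m<n⇒m%n≡m u+i∸n<n) ⟩
  toℕ u + i ∸ n + n          ≡⟨ ℕ.m∸n+n≡m n≤u+i ⟩
  toℕ u + i                  ∎))
  where
  open ≡-Reasoning
  n≤u+i = ℕ.≮⇒≥ u+i≮n
  u+i∸n<n : toℕ u + i ∸ n < n
  u+i∸n<n = ℕ.+-cancelʳ-< n _ n (subst (_< n + n) (sym (ℕ.m∸n+n≡m n≤u+i)) (ℕ.+-mono-< (Fin.toℕ<n u) i<n))

-- A step back by i is a step forward by n - i, so all neighbours can be listed as forward steps.
⊕-inverse : ∀ {n} (u v : Fin n) {i} j → i < n → j + i ≡ n → v ⊕ i ≡ u → u ⊕ j ≡ v
⊕-inverse u v {i} j i<n refl eq with ⊕-cases v u i<n eq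
... | inj₁ p = ⊕-≡-wrap u v (begin
  toℕ u + j        ≡⟨ cong (_+ j) p ⟨
  toℕ v + i + j    ≡⟨ ℕ.+-assoc (toℕ v) i j ⟩
  toℕ v + (i + j)  ≡⟨ cong (toℕ v +_) (ℕ.+-comm i j) ⟩
  toℕ v + (j + i)  ∎)
  where open ≡-Reasoning
... | inj₂ p = ⊕-≡ u v (sym (ℕ.+-cancelʳ-≡ i (toℕ v) (toℕ u + j) (trans p (sym (ℕ.+-assoc (toℕ u) j i)))))

-- Edges and colours of C(n,{1,3}) in terms of labels, for both residues of n mod 4.

module _ (m : ℕ) (8≤n : 8 ≤ 8 + m) where
  private
    n = 8 + m
    G = C[ n ,⟨1,3⟩] 8≤n
    open Graph G using (Adj; adj-sym)

    1<n : 1 < n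
    1<n = s≤s (s≤s z≤n)

    3<n : 3 < n
    3<n = s≤s (s≤s (s≤s (s≤s z≤n)))

  -- Directed as in the colour lists, smaller label first. In a wrapping edge the circulant step
  -- therefore starts at b and ends at a.
  data Step (a b : ℕ) : Set where
    forward₁ : a + 1 ≡ b → Step a b
    forward₃ : a + 3 ≡ b → Step a b
    wrap₁    : b + 1 ≡ a + n → Step a b
    wrap₃    : b + 3 ≡ a + n → Step a b

  step⇒adj : ∀ u v → Step (label u) (label v) → Adj u v
  step⇒adj u v (forward₁ eq) = here (inj₁ (⊕-≡ u v (ℕ.suc-injective eq)))
  step⇒adj u v (forward₃ eq) = there (here (inj₁ (⊕-≡ u v (ℕ.suc-injective eq))))
  step⇒adj u v (wrap₁ eq)    = here (inj₂ (⊕-≡-wrap v u (ℕ.suc-injective eq)))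
  step⇒adj u v (wrap₃ eq)    = there (here (inj₂ (⊕-≡-wrap v u (ℕ.suc-injective eq))))

  adj⇒step : ∀ u v → Adj u v → Step (label u) (label v) ⊎ Step (label v) (label u)
  adj⇒step u v (here (inj₁ eq)) with ⊕-cases u v 1<n eq
  ... | inj₁ p = inj₁ (forward₁ (cong suc p))
  ... | inj₂ p = inj₂ (wrap₁ (cong suc p))
  adj⇒step u v (here (inj₂ eq)) with ⊕-cases v u 1<n eq
  ... | inj₁ p = inj₂ (forward₁ (cong suc p))
  ... | inj₂ p = inj₁ (wrap₁ (cong suc p))
  adj⇒step u v (there (here (inj₁ eq))) with ⊕-cases u v 3<n eq
  ... | inj₁ p = inj₁ (forward₃ (cong suc p))
  ... | inj₂ p = inj₂ (wrap₃ (cong suc p))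
  adj⇒step u v (there (here (inj₂ eq))) with ⊕-cases v u 3<n eq
  ... | inj₁ p = inj₂ (forward₃ (cong suc p))
  ... | inj₂ p = inj₁ (wrap₃ (cong suc p))

  maxDegree≡4 : Graph.maxDegree G ≡ 4
  -- `3F` is the vertex 4, the first one whose neighbours 1, 3, 5, 7 are all reached without
  -- wrapping, so that `refl` proves the adjacencies.
  maxDegree≡4 = maxDegree-≡ G nearby 4 3F (0F ∷ 2F ∷ 4F ∷ 6F ∷ []) (λ _ → ℕ.≤-refl) (λ {v} {w} → adj⇒∈ v w)
    (((λ ()) ∷ (λ ()) ∷ (λ ()) ∷ []) ∷ ((λ ()) ∷ (λ ()) ∷ []) ∷ ((λ ()) ∷ []) ∷ [] ∷ [])
    ∈⇒adj ℕ.≤-refl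
    where
    nearby : Fin n → List (Fin n)
    -- `7 + m` and `5 + m` are n - 1 and n - 3, the steps back by 1 and 3.
    nearby v = v ⊕ 1 ∷ v ⊕ 3 ∷ v ⊕ (7 + m) ∷ v ⊕ (5 + m) ∷ []

    adj⇒∈ : ∀ v w → Adj v w → w ∈ nearby v
    adj⇒∈ v w (here (inj₁ eq))         = here (sym eq)
    adj⇒∈ v w (there (here (inj₁ eq))) = there (here (sym eq))
    adj⇒∈ v w (here (inj₂ eq))         =
      there (there (here (sym (⊕-inverse v w (7 + m) 1<n (ℕ.+-comm (7 + m) 1) eq))))
    adj⇒∈ v w (there (here (inj₂ eq))) =
      there (there (there (here (sym (⊕-inverse v w (5 + m) 3<n (ℕ.+-comm (5 + m) 3) eq)))))

    ∈⇒adj : ∀ {w} → w ∈ 0F ∷ 2F ∷ 4F ∷ 6F ∷ [] → Adj 3F w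
    ∈⇒adj (here refl)                         = there (here (inj₂ refl))
    ∈⇒adj (there (here refl))                 = here (inj₂ refl)
    ∈⇒adj (there (there (here refl)))         = here (inj₁ refl)
    ∈⇒adj (there (there (there (here refl)))) = there (here (inj₁ refl))

  -- χ c is the colour of (4 + c)-(7 + c) and (5 + c)-(6 + c), while χ₄ and χₙ
  -- are those of 4-5 and (n - 1)-n.
  module _ (χ : ℕ → Fin 4) (χ₄ χₙ : Fin 4) where

    data Edge : Fin 4 → ℕ × ℕ → Set where
      twisted : ∀ {i e} → e ∈ twist n i → Edge i e
      outer   : ∀ {i c} → 7 + c ≤ n → χ c ≡ i → Edge i ((4 + c) — (7 + c))
      inner   : ∀ {i c} → 7 + c ≤ n → χ c ≡ i → Edge i ((5 + c) — (6 + c))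
      first   : ∀ {i} → χ₄ ≡ i → Edge i (4 — 5)
      last    : ∀ {i} → χₙ ≡ i → Edge i ((7 + m) — n)

    edge⇒step : ∀ {i a b} → Edge i (a , b) → Step a b
    edge⇒step (twisted {red}    (here refl))                 = forward₁ refl
    edge⇒step (twisted {red}    (there (here refl)))         = forward₁ refl
    edge⇒step (twisted {blue}   (here refl))                 = forward₁ refl
    edge⇒step (twisted {blue}   (there (here refl)))         = wrap₁ (ℕ.+-comm n 1)
    edge⇒step (twisted {green}  (here refl))                 = wrap₃ (ℕ.+-comm n 3)
    edge⇒step (twisted {green}  (there (here refl)))         = wrap₃ (ℕ.+-comm (7 + m) 3)
    edge⇒step (twisted {green}  (there (there (here refl)))) = wrap₃ (ℕ.+-comm (6 + m) 3)
    edge⇒step (twisted {purple} (here refl))                 = forward₃ refl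
    edge⇒step (twisted {purple} (there (here refl)))         = forward₃ refl
    edge⇒step (twisted {purple} (there (there (here refl)))) = forward₃ refl
    edge⇒step (outer {c = c} _ _) = forward₃ (ℕ.+-comm (4 + c) 3)
    edge⇒step (inner {c = c} _ _) = forward₁ (ℕ.+-comm (5 + c) 1)
    edge⇒step (first _) = forward₁ refl
    edge⇒step (last _)  = forward₁ (ℕ.+-comm (7 + m) 1)

    edge⇒< : ∀ {i a b} → Edge i (a , b) → a < b
    edge⇒< (twisted {red}    (here refl))                 = ℕ.m<m+n 1 (s≤s z≤n)
    edge⇒< (twisted {red}    (there (here refl)))         = ℕ.m<m+n 3 (s≤s z≤n)
    edge⇒< (twisted {blue}   (here refl))                 = ℕ.m<m+n 2 (s≤s z≤n)
    edge⇒< (twisted {blue}   (there (here refl)))         = ℕ.m<m+n 1 (s≤s z≤n)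
    edge⇒< (twisted {green}  (here refl))                 = ℕ.m<m+n 3 (s≤s z≤n)
    edge⇒< (twisted {green}  (there (here refl)))         = ℕ.m<m+n 2 (s≤s z≤n)
    edge⇒< (twisted {green}  (there (there (here refl)))) = ℕ.m<m+n 1 (s≤s z≤n)
    edge⇒< (twisted {purple} (here refl))                 = ℕ.m<m+n 1 (s≤s z≤n)
    edge⇒< (twisted {purple} (there (here refl)))         = ℕ.m<m+n 2 (s≤s z≤n)
    edge⇒< (twisted {purple} (there (there (here refl)))) = ℕ.m<m+n 3 (s≤s z≤n)
    edge⇒< (outer {c = c} _ _) = ℕ.m<n+m (4 + c) {3} (s≤s z≤n)
    edge⇒< (inner {c = c} _ _) = ℕ.m<n+m (5 + c) {1} (s≤s z≤n)
    edge⇒< (first _) = ℕ.m<m+n 4 (s≤s z≤n)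
    edge⇒< (last _)  = ℕ.m<n+m (7 + m) {1} (s≤s z≤n)

    -- As b ≤ n, an edge that wraps by 1 has a ≤ 1 and one that wraps by 3 has a ≤ 3. These are
    -- twist edges, and so are the forward edges from 1, 2 and 3; from 4 on only the periodic pairs
    -- and the two end edges remain.
    step⇒edge : ∀ {a b} → 1 ≤ a → b ≤ n → Step a b → ∃[ i ] Edge i (a , b)
    step⇒edge {1} _ _ (forward₁ refl) = red , twisted (here refl)
    step⇒edge {2} _ _ (forward₁ refl) = blue , twisted (here refl)
    step⇒edge {3} _ _ (forward₁ refl) = red , twisted (there (here refl))
    step⇒edge {4} _ _ (forward₁ refl) = χ₄ , first refl
    -- Here b = 6 + c: if b < n, the whole pair fits, since 7 + c ≤ n; if b = n, this is the edge (n
    -- - 1)-n.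
    step⇒edge {suc (suc (suc (suc (suc c))))} _ b≤n (forward₁ refl) rewrite ℕ.+-comm c 1 with ℕ.m≤n⇒m<n∨m≡n b≤n
    ... | inj₁ b<n  = χ c , inner b<n refl
    ... | inj₂ refl = χₙ , last refl
    step⇒edge {1} _ _ (forward₃ refl) = purple , twisted (here refl)
    step⇒edge {2} _ _ (forward₃ refl) = purple , twisted (there (here refl))
    step⇒edge {3} _ _ (forward₃ refl) = purple , twisted (there (there (here refl)))
    step⇒edge {suc (suc (suc (suc c)))} _ b≤n (forward₃ refl) rewrite ℕ.+-comm c 3 = χ c , outer b≤n refl
    step⇒edge {a} {b} 1≤a b≤n (wrap₁ eq) = wrap a 1≤a a≤1 eq
      where
      a≤1 : a ≤ 1
      a≤1 = ℕ.+-cancelˡ-≤ n a 1 (subst (_≤ n + 1) (trans eq (ℕ.+-comm a n)) (ℕ.+-monoˡ-≤ 1 b≤n))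
      wrap : ∀ a → 1 ≤ a → a ≤ 1 → b + 1 ≡ a + n → ∃[ i ] Edge i (a , b)
      wrap 1 _ _ eq with refl ← trans (ℕ.+-comm 1 b) eq = blue , twisted (there (here refl))
      wrap (suc (suc _)) _ (s≤s ())
    step⇒edge {a} {b} 1≤a b≤n (wrap₃ eq) = wrap a 1≤a a≤3 eq
      where
      a≤3 : a ≤ 3
      a≤3 = ℕ.+-cancelˡ-≤ n a 3 (subst (_≤ n + 3) (trans eq (ℕ.+-comm a n)) (ℕ.+-monoˡ-≤ 3 b≤n))
      wrap : ∀ a → 1 ≤ a → a ≤ 3 → b + 3 ≡ a + n → ∃[ i ] Edge i (a , b)
      wrap 1 _ _ eq with refl ← trans (ℕ.+-comm 3 b) eq = green , twisted (there (there (here refl)))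
      wrap 2 _ _ eq with refl ← trans (ℕ.+-comm 3 b) eq = green , twisted (there (here refl))
      wrap 3 _ _ eq with refl ← trans (ℕ.+-comm 3 b) eq = green , twisted (here refl)
      wrap (suc (suc (suc (suc _)))) _ (s≤s (s≤s (s≤s ())))

    -- A left inverse that makes colours unique: each constructor of `Edge` is checked against it
    -- once. Values at pairs that are no edges, such as those with label 0, are arbitrary.
    colourOf : ℕ → ℕ → Fin 4
    colourOf 1 2 = red
    colourOf 1 4 = purple
    colourOf 1 b = if does (b ℕ.≟ n) then blue else green
    colourOf 2 3 = blue
    colourOf 2 5 = purple
    colourOf 2 b = green
    colourOf 3 4 = red
    colourOf 3 6 = purple
    colourOf 3 b = green
    colourOf (suc (suc (suc (suc c)))) b = if does (b ℕ.≟ 7 + c) then χ c else successor c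
      where
      successor : ℕ → Fin 4
      successor zero    = χ₄
      successor (suc c) = if does (b ℕ.≟ n) then χₙ else χ c
    colourOf 0 b = red

    edge⇒colourOf : ∀ {i a b} → Edge i (a , b) → colourOf a b ≡ i
    edge⇒colourOf (twisted {red}    (here refl))                 = refl
    edge⇒colourOf (twisted {red}    (there (here refl)))         = refl
    edge⇒colourOf (twisted {blue}   (here refl))                 = refl
    edge⇒colourOf (twisted {blue}   (there (here refl)))         = cong (if_then blue else green) (dec-true (n ℕ.≟ n) refl)
    edge⇒colourOf (twisted {green}  (here refl))                 = refl
    edge⇒colourOf (twisted {green}  (there (here refl)))         = refl
    edge⇒colourOf (twisted {green}  (there (there (here refl)))) =
      cong (if_then blue else green) (dec-false (6 + m ℕ.≟ n) (ℕ.<⇒≢ (ℕ.m<n+m (6 + m) {2} (s≤s z≤n))))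
    edge⇒colourOf (twisted {purple} (here refl))                 = refl
    edge⇒colourOf (twisted {purple} (there (here refl)))         = refl
    edge⇒colourOf (twisted {purple} (there (there (here refl)))) = refl
    edge⇒colourOf (outer {c = c} _ eq)
      rewrite dec-true (7 + c ℕ.≟ 7 + c) refl = eq
    edge⇒colourOf (inner {c = c} 7+c≤n eq)
      rewrite dec-false (6 + c ℕ.≟ 8 + c) (ℕ.<⇒≢ (ℕ.m<n+m (6 + c) {2} (s≤s z≤n)))
            | dec-false (6 + c ℕ.≟ n) (ℕ.<⇒≢ 7+c≤n) = eq
    edge⇒colourOf (first eq) = eq
    edge⇒colourOf (last eq)
      rewrite dec-false (n ℕ.≟ 7 + (3 + m)) (ℕ.<⇒≢ (ℕ.m<n+m n {2} (s≤s z≤n)))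
            | dec-true (n ℕ.≟ n) refl = eq

    -- Collects what depends on n mod 4. `page` lists the edges of a colour again, now in the order
    -- of nesting and succession that `Planar` follows and the twist lists do not.
    record Describes : Set where
      field
        sound    : ∀ {i e} → HasColour n i e → Edge i e
        complete : ∀ {i e} → Edge i e → HasColour n i e
        page     : Fin 4 → List (ℕ × ℕ)
        planar   : ∀ i → ∃₂ λ l h → Planar (place n) l h (page i)
        on-page  : ∀ {i e} → HasColour n i e → e ∈ page i

    module _ (C : Describes) where
      open Describes C

      isEdgeColouring : IsEdgeColouring G (colouring n)
      isEdgeColouring = record
        { onEdges    = λ { {u = u} {v} (inj₁ c) → step⇒adj u v (edge⇒step (sound c))
                         ; {u = u} {v} (inj₂ c) → adj-sym {v} {u} (step⇒adj v u (edge⇒step (sound c))) }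
        ; undirected = swap
        ; total      = λ {u} {v} adj → [ (λ st → coloured u v st) , (λ st → swapped (coloured v u st)) ]′ (adj⇒step u v adj)
        ; unique     = unique
        ; allUsed    = λ
          { red    → 0F , 1F , inj₁ (inTwist (here refl))
          ; blue   → 1F , 2F , inj₁ (inTwist (here refl))
          ; green  → 2F , Fin.fromℕ (7 + m) , inj₁ (inTwist (here (cong (λ k → 3 , suc k) (Fin.toℕ-fromℕ (7 + m)))))
          ; purple → 0F , 3F , inj₁ (inTwist (here refl)) }
        }
        where
        coloured : ∀ u v → Step (label u) (label v) → ∃[ i ] colouring n i u v
        coloured u v st with step⇒edge (s≤s z≤n) (Fin.toℕ<n v) st
        ... | i , e = i , inj₁ (complete e)

        swapped : ∀ {u v} → ∃[ i ] colouring n i u v → ∃[ i ] colouring n i v u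
        swapped (i , c) = i , swap c

        unique : ∀ {i j u v} → colouring n i u v → colouring n j u v → i ≡ j
        unique (inj₁ c) (inj₁ d) = trans (sym (edge⇒colourOf (sound c))) (edge⇒colourOf (sound d))
        unique (inj₂ c) (inj₂ d) = trans (sym (edge⇒colourOf (sound c))) (edge⇒colourOf (sound d))
        -- An edge listed in both directions would have each label smaller than the other.
        unique (inj₁ c) (inj₂ d) = contradiction (edge⇒< (sound d)) (ℕ.<-asym (edge⇒< (sound c)))
        unique (inj₂ c) (inj₁ d) = contradiction (edge⇒< (sound d)) (ℕ.<-asym (edge⇒< (sound c)))

      Separated : (u v w x : Fin n) → Set
      Separated u v w x = Apart (place n) (label u , label v) (label w , label x)
                        ⊎ Apart (place n) (label w , label x) (label u , label v)

      separated-swapˡ : ∀ {u v w x} → Separated u v w x → Separated v u w x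
      separated-swapˡ = [ inj₁ ∘ apart-swapˡ (place n) , inj₂ ∘ apart-swapʳ (place n) ]′

      separated-swapʳ : ∀ {u v w x} → Separated u v w x → Separated u v x w
      separated-swapʳ = [ inj₁ ∘ apart-swapʳ (place n) , inj₂ ∘ apart-swapˡ (place n) ]′

      separated : ∀ {i u v w x} → colouring n i u v → colouring n i w x →
                  ¬ SameEdge u v w x → Separated u v w x
      separated {i} = unoriented
        where
        label-injective : ∀ {u v : Fin n} → label u ≡ label v → u ≡ v
        label-injective = Fin.toℕ-injective ∘ ℕ.suc-injective

        oriented : ∀ {u v w x} → HasColour n i (label u , label v) → HasColour n i (label w , label x) →
                   ¬ SameEdge u v w x → Separated u v w x
        oriented c d differ with planar-apart (place n) (proj₂ (proj₂ (planar i))) (on-page c) (on-page d)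
        ... | inj₁ eq    = contradiction (inj₁ (label-injective (cong proj₁ eq) , label-injective (cong proj₂ eq))) differ
        ... | inj₂ apart = apart

        unoriented : ∀ {u v w x} → colouring n i u v → colouring n i w x →
                     ¬ SameEdge u v w x → Separated u v w x
        unoriented (inj₁ c) (inj₁ d) differ = oriented c d differ
        unoriented {u} {v} {w} {x} (inj₁ c) (inj₂ d) differ =
          separated-swapʳ {u} {v} {x} {w} (oriented c d (differ ∘ swap))
        unoriented {u} {v} {w} {x} (inj₂ c) (inj₁ d) differ =
          separated-swapˡ {v} {u} {w} {x} (oriented c d (differ ∘ [ inj₂ ∘ ×-swap , inj₁ ∘ ×-swap ]′))
        unoriented {u} {v} {w} {x} (inj₂ c) (inj₂ d) differ =
          separated-swapˡ {v} {u} {w} {x} (separated-swapʳ {v} {u} {x} {w}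
            (oriented c d (differ ∘ [ inj₁ ∘ ×-swap , inj₂ ∘ ×-swap ]′)))

      isDispersable : IsDispersableMatchingBookEmbedding G (τ n) (colouring n)
      isDispersable = record
        { isMatchingBookEmbedding = record
          { isEdgeColouring = isEdgeColouring
          ; noCrossing      = λ D {u = u} {v} {w} {x} c d differ (_ , P∈uv , P∈wx , _) →
              [ (λ a → oneSide⇒disjoint (5 + m) D {u} {v} {w} {x} (apart⇒oneSide (place n) a) P∈uv P∈wx)
              , (λ a → oneSide⇒disjoint (5 + m) D {w} {x} {u} {v} (apart⇒oneSide (place n) a) P∈wx P∈uv)
              ]′ (separated {u = u} {v} {w} {x} c d differ)
          ; isMatching      = λ {u = u} {v} {w} {x} c d differ →
              [ (λ a → disjoint {u} {v} {w} {x} (apart⇒oneSide (place n) a))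
              , (λ a → disjoint {w} {x} {u} {v} (apart⇒oneSide (place n) a) ∘ shareEndpoint-sym {u} {v} {w} {x})
              ]′ (separated {u = u} {v} {w} {x} c d differ)
          }
        ; pages≡maxDegree = sym maxDegree≡4
        }
        where
        disjoint : ∀ {u v w x : Fin n} → OneSide (place n) (label u) (label v) (label w) (label x) →
                   ¬ ShareEndpoint u v w x
        disjoint s with oneSide⇒≢ (place n) s
        ... | (u≢w , u≢x) , (v≢w , v≢x) = [ [ u≢w ∘ cong label , u≢x ∘ cong label ]′
                                          , [ v≢w ∘ cong label , v≢x ∘ cong label ]′ ]′

        shareEndpoint-sym : ∀ {u v w x : Fin n} → ShareEndpoint u v w x → ShareEndpoint w x u v
        shareEndpoint-sym (inj₁ (inj₁ p)) = inj₁ (inj₁ (sym p))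
        shareEndpoint-sym (inj₁ (inj₂ p)) = inj₂ (inj₁ (sym p))
        shareEndpoint-sym (inj₂ (inj₁ p)) = inj₁ (inj₂ (sym p))
        shareEndpoint-sym (inj₂ (inj₂ p)) = inj₂ (inj₂ (sym p))

-- Runs of nested pairs and their periodic colours.

nestedPair : ℕ → List (ℕ × ℕ)
nestedPair a = a — (a + 3) ∷ (a + 1) — (a + 2) ∷ []

-- Each pair fills four consecutive places, and from label 4 on places are labels. The function `g`
-- is general because `applyUpTo` recurses through `g ∘ suc`.
planar-nestedPairs : ∀ n l k (g : ℕ → ℕ) → (∀ t → g t ≡ l + 4 * t) → 4 ≤ l →
               Planar (place n) l (l + k * 4) (concatMap nestedPair (applyUpTo g k))
planar-nestedPairs n l zero    g g≡ 4≤l rewrite ℕ.+-identityʳ l = []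
planar-nestedPairs n l (suc k) g g≡ 4≤l
  rewrite trans (g≡ 0) (ℕ.+-identityʳ l) | sym (ℕ.+-assoc l 4 (k * 4)) | ℕ.+-comm l 4 | ℕ.+-comm l 3 =
  arc (inj₁ (place-≥4 n 4≤l , place-≥4 n (ℕ.m≤n⇒m≤o+n 3 4≤l)))
    (arc (inj₁ (fixed 1 , fixed 2)) [])
  ⋆ planar-nestedPairs n (4 + l) k (g ∘ suc) (λ t → trans (g≡ (suc t)) (shift l t)) (ℕ.m≤n⇒m≤o+n 4 4≤l)
  where
  shift : ∀ l t → l + 4 * suc t ≡ 4 + l + 4 * t
  shift = solve-∀
  fixed : ∀ i → place n (l + i) ≡ i + l
  fixed i = trans (place-≥4 n (ℕ.m≤n⇒m≤n+o i 4≤l)) (ℕ.+-comm l i)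

planar-nested : ∀ n r k → Planar (place n) (4 + r) (4 + r + k * 4) (nested r k)
planar-nested n r k = planar-nestedPairs n (4 + r) k _ (shift r) (ℕ.m≤m+n 4 r)
  where
  shift : ∀ r t → r + 4 * suc t ≡ 4 + r + 4 * t
  shift = solve-∀

-- With first label 4 + c, the pairs of `nested r` are those with c = r + t * 4, the form that
-- `divMod` returns: the remainder selects the run and the quotient is the index in it.
pair : ℕ → List (ℕ × ℕ)
pair c = (4 + c) — (7 + c) ∷ (5 + c) — (6 + c) ∷ []

nestedPair-≡ : ∀ r t → nestedPair (r + 4 * suc t) ≡ pair (r + t * 4)
nestedPair-≡ r t = cong₂ (λ e f → e ∷ f ∷ [])
  (cong₂ _,_ (eq₀ r t) (eq₃ r t)) (cong₂ _,_ (eq₁ r t) (eq₂ r t))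
  where
  eq₀ : ∀ r t → r + 4 * suc t ≡ 4 + (r + t * 4)
  eq₀ = solve-∀
  eq₁ : ∀ r t → r + 4 * suc t + 1 ≡ 5 + (r + t * 4)
  eq₁ = solve-∀
  eq₂ : ∀ r t → r + 4 * suc t + 2 ≡ 6 + (r + t * 4)
  eq₂ = solve-∀
  eq₃ : ∀ r t → r + 4 * suc t + 3 ≡ 7 + (r + t * 4)
  eq₃ = solve-∀

∈-nested⁺ : ∀ {r k t e} → t < k → e ∈ pair (r + t * 4) → e ∈ nested r k
∈-nested⁺ {r} {k} {t} {e} t<k e∈ = ∈-concatMap⁺ nestedPair
  (Any.map (λ { refl → subst (e ∈_) (sym (nestedPair-≡ r t)) e∈ }) (∈-applyUpTo⁺ _ t<k))

∈-nested⁻ : ∀ {r k e} → e ∈ nested r k → ∃[ t ] t < k × e ∈ pair (r + t * 4)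
∈-nested⁻ {r} {k} {e} e∈ with find (∈-concatMap⁻ nestedPair {xs = applyUpTo (λ t → r + 4 * suc t) k} e∈)
... | a , a∈ , e∈pair with ∈-applyUpTo⁻ _ a∈
...   | t , t<k , refl = t , t<k , subst (e ∈_) (nestedPair-≡ r t) e∈pair

periodic : (Fin 4 → Fin 4) → ℕ → Fin 4
periodic p 0 = p 0F
periodic p 1 = p 1F
periodic p 2 = p 2F
periodic p 3 = p 3F
periodic p (suc (suc (suc (suc c)))) = periodic p c

periodic-≡ : ∀ p r t → periodic p (toℕ r + t * 4) ≡ p r
periodic-≡ p 0F zero = refl
periodic-≡ p 1F zero = refl
periodic-≡ p 2F zero = refl
periodic-≡ p 3F zero = refl
periodic-≡ p 0F (suc t) = periodic-≡ p 0F t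
periodic-≡ p 1F (suc t) = periodic-≡ p 1F t
periodic-≡ p 2F (suc t) = periodic-≡ p 2F t
periodic-≡ p 3F (suc t) = periodic-≡ p 3F t

-- `HasColour` allows every k with n = 4k or n = 4k + 2; this rules out the clause for the other
-- residue.
4a≢4b+2 : ∀ a b → a * 4 ≢ 4 * b + 2
4a≢4b+2 a b rewrite ℕ.*-comm 4 b = go a b
  where
  go : ∀ a b → a * 4 ≢ b * 4 + 2
  go zero    zero    ()
  go (suc a) zero    ()
  go (suc a) (suc b) eq = go a b (ℕ.+-cancelˡ-≡ 4 _ _ eq)

module _ (m : ℕ) (8≤n : 8 ≤ 8 + m) (p : Fin 4 → Fin 4) (χ₄ χₙ : Fin 4) where
  private
    n = 8 + m
    χ = periodic p

  -- The last pair of the run has c = r + (k - 1) * 4, so its largest label 7 + c is 3 + (r + k *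
  -- 4).
  nested⇒edge : ∀ r k {e} → 3 + (toℕ r + k * 4) ≤ n → e ∈ nested (toℕ r) k → Edge m 8≤n χ χ₄ χₙ (p r) e
  nested⇒edge r k bound e∈ with ∈-nested⁻ {toℕ r} {k} e∈
  ... | t , t<k , e∈pair = edge e∈pair
    where
    7+c≤n : 7 + (toℕ r + t * 4) ≤ n
    7+c≤n = ℕ.≤-trans (subst (_≤ 3 + (toℕ r + k * 4)) (shift (toℕ r) t)
      (ℕ.+-monoʳ-≤ 3 (ℕ.+-monoʳ-≤ (toℕ r) (ℕ.*-monoˡ-≤ 4 t<k)))) bound
      where
      shift : ∀ r t → 3 + (r + (4 + t * 4)) ≡ 7 + (r + t * 4)
      shift = solve-∀
    edge : ∀ {e} → e ∈ pair (toℕ r + t * 4) →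
           Edge m 8≤n χ χ₄ χₙ (p r) e
    edge (here refl)         = outer 7+c≤n (periodic-≡ p r t)
    edge (there (here refl)) = inner 7+c≤n (periodic-≡ p r t)

  module _ (remaining : Fin 4 → List (ℕ × ℕ)) (count : Fin 4 → ℕ)
           (t<count : ∀ r t → 7 + (toℕ r + t * 4) ≤ n → t < count r)
           (nested⊆ : ∀ r {e} → e ∈ nested (toℕ r) (count r) → e ∈ remaining (p r))
           (first∈ : 4 — 5 ∈ remaining χ₄) (last∈ : (7 + m) — n ∈ remaining χₙ) where

    -- The remainder of c mod 4 determines the run, and `t<count` says that the run is long enough
    -- to contain every pair that fits below n.
    edge⇒∈ : ∀ {i e} → Edge m 8≤n χ χ₄ χₙ i e → e ∈ twist n i ⊎ e ∈ remaining i
    edge⇒∈ (twisted e∈) = inj₁ e∈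
    edge⇒∈ (outer {c = c} 7+c≤n refl) with c divMod 4
    ... | result t r refl rewrite periodic-≡ p r t = inj₂ (nested⊆ r (∈-nested⁺ (t<count r t 7+c≤n) (here refl)))
    edge⇒∈ (inner {c = c} 7+c≤n refl) with c divMod 4
    ... | result t r refl rewrite periodic-≡ p r t = inj₂ (nested⊆ r (∈-nested⁺ (t<count r t 7+c≤n) (there (here refl))))
    edge⇒∈ (first refl) = inj₂ first∈
    edge⇒∈ (last refl)  = inj₂ last∈

-- The case n = 4k, with k = 2 + j.

module _ (j : ℕ) where
  private
    n = 8 + j * 4

    p : Fin 4 → Fin 4
    p 0F = blue
    p 1F = red
    p 2F = green
    p 3F = purple

    count : Fin 4 → ℕ
    count 0F = 1 + j
    count 1F = 1 + j
    count 2F = j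
    count 3F = j

    n≡4k : n ≡ 4 * (2 + j)
    n≡4k = ℕ.*-comm (2 + j) 4

    -- The bound amounts to 4t ≤ 4j + 1 - r, which admits t = j for r ≤ 1 but not for r ≥ 2. Hence
    -- two runs are one pair shorter.
    t<count : ∀ r t → 7 + (toℕ r + t * 4) ≤ n → t < count r
    t<count 0F t le = ℕ.*-cancelʳ-< 4 t (1 + j) (ℕ.m≤n⇒m≤o+n 2 (s≤s (ℕ.+-cancelˡ-≤ 7 _ _ le)))
    t<count 1F t le = ℕ.*-cancelʳ-< 4 t (1 + j) (ℕ.m≤n⇒m≤o+n 3 (ℕ.+-cancelˡ-≤ 7 _ _ le))
    t<count 2F t le = ℕ.*-cancelʳ-< 4 t j (ℕ.+-cancelˡ-≤ 8 _ _ le)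
    t<count 3F t le = ℕ.*-cancelʳ-< 4 t j (ℕ.≤-trans (ℕ.n≤1+n _) (ℕ.+-cancelˡ-≤ 8 _ _ le))

    page : Fin 4 → List (ℕ × ℕ)
    page red    = (3 — 4 ∷ nested 1 (1 + j)) ++ 1 — 2 ∷ []
    page blue   = nested 0 (1 + j) ++ 1 — n ∷ 2 — 3 ∷ []
    page green  = (4 — 5 ∷ []) ++ nested 2 j ++ 1 — (6 + j * 4) ∷ 2 — (7 + j * 4) ∷ 3 — n ∷ []
    page purple = 1 — 4 ∷ 2 — 5 ∷ 3 — 6 ∷ nested 3 j ++ (7 + j * 4) — n ∷ []

    twist⊆page : ∀ {i e} → e ∈ twist n i → e ∈ page i
    twist⊆page {red}    (here e≡)                 = ∈-++⁺ʳ (3 — 4 ∷ nested 1 (1 + j)) (here e≡)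
    twist⊆page {red}    (there (here e≡))         = here e≡
    twist⊆page {blue}   (here e≡)                 = ∈-++⁺ʳ (nested 0 (1 + j)) (there (here e≡))
    twist⊆page {blue}   (there (here e≡))         = ∈-++⁺ʳ (nested 0 (1 + j)) (here e≡)
    twist⊆page {green}  (here e≡)                 = there (∈-++⁺ʳ (nested 2 j) (there (there (here e≡))))
    twist⊆page {green}  (there (here e≡))         = there (∈-++⁺ʳ (nested 2 j) (there (here e≡)))
    twist⊆page {green}  (there (there (here e≡))) = there (∈-++⁺ʳ (nested 2 j) (here e≡))
    twist⊆page {purple} (here e≡)                 = here e≡
    twist⊆page {purple} (there (here e≡))         = there (here e≡)
    twist⊆page {purple} (there (there (here e≡))) = there (there (here e≡))

    remaining⊆page : ∀ {i e} → e ∈ remaining-4k n (2 + j) i → e ∈ page i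
    remaining⊆page {red}    e∈ = there (∈-++⁺ˡ e∈)
    remaining⊆page {blue}   e∈ = ∈-++⁺ˡ e∈
    remaining⊆page {green}  e∈ with ∈-++⁻ (nested 2 j) e∈
    ... | inj₁ e∈nested  = there (∈-++⁺ˡ e∈nested)
    ... | inj₂ (here e≡) = here e≡
    remaining⊆page {purple} e∈ = there (there (there e∈))

    hasColour⁻ : ∀ {i e} → HasColour n i e → e ∈ twist n i ⊎ e ∈ remaining-4k n (2 + j) i
    hasColour⁻ (inTwist e∈)      = inj₁ e∈
    hasColour⁻ (in-4k k n≡ e∈)
      with refl ← ℕ.*-cancelˡ-≡ (2 + j) k 4 (trans (sym n≡4k) n≡) = inj₂ e∈
    hasColour⁻ (in-4k+2 k n≡ e∈) = contradiction n≡ (4a≢4b+2 (2 + j) k)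

  describes-4k : ∀ 8≤n → Describes (j * 4) 8≤n (periodic p) green purple
  describes-4k 8≤n = record
    { sound    = [ twisted , sound ]′ ∘ hasColour⁻
    ; complete = [ inTwist , in-4k (2 + j) n≡4k ]′ ∘ edge⇒∈ (j * 4) 8≤n p green purple (remaining-4k n (2 + j))
        count t<count
        (λ { 0F → id ; 1F → id ; 2F → ∈-++⁺ˡ ; 3F → ∈-++⁺ˡ })
        (∈-++⁺ʳ (nested 2 j) (here refl)) (∈-++⁺ʳ (nested 3 j) (here refl))
    ; page     = page
    -- The interval 4, ..., n + 3 consists of all places. `inj₂` marks the twist edges, whose
    -- smaller label 1, 2 or 3 has the higher place.
    ; planar   = λ
        { red    → 4 , 4 + n , arc (inj₂ (refl , refl)) (planar-nested n 1 (1 + j)) ⋆ arc (inj₂ (refl , refl)) []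
        ; blue   → 4 , 4 + n , planar-nested n 0 (1 + j) ⋆ arc (inj₂ (refl , refl)) (arc (inj₂ (refl , refl)) [])
        ; green  → 4 , 4 + n , arc (inj₁ (refl , refl)) [] ⋆ planar-nested n 2 j
                     ⋆ arc (inj₂ (refl , refl)) (arc (inj₂ (refl , refl)) (arc (inj₂ (refl , refl)) []))
        ; purple → 4 , 4 + n , arc (inj₂ (refl , refl)) (arc (inj₂ (refl , refl)) (arc (inj₂ (refl , refl))
                     (planar-nested n 3 j ⋆ arc (inj₁ (refl , refl)) [])))
        }
    ; on-page  = λ {i} → [ twist⊆page {i} , remaining⊆page {i} ]′ ∘ hasColour⁻
    }
    where
    nested⇒ = nested⇒edge (j * 4) 8≤n p green purple

    sound : ∀ {i e} → e ∈ remaining-4k n (2 + j) i → Edge (j * 4) 8≤n (periodic p) green purple i e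
    -- The slacks 0, 1, 3, 2 in these four bounds count the labels up to n that are left above the
    -- run of the colour.
    sound {red}    e∈ = nested⇒ 1F (1 + j) ℕ.≤-refl e∈
    sound {blue}   e∈ = nested⇒ 0F (1 + j) (ℕ.m≤n+m _ 1) e∈
    sound {green}  e∈ with ∈-++⁻ (nested 2 j) e∈
    ... | inj₁ e∈nested    = nested⇒ 2F j (ℕ.m≤n+m _ 3) e∈nested
    ... | inj₂ (here refl) = first refl
    sound {purple} e∈ with ∈-++⁻ (nested 3 j) e∈
    ... | inj₁ e∈nested    = nested⇒ 3F j (ℕ.m≤n+m _ 2) e∈nested
    ... | inj₂ (here refl) = last refl

-- The case n = 4k + 2, with k = 2 + j.

module _ (j : ℕ) where
  private
    n = 10 + j * 4

    p : Fin 4 → Fin 4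
    p 0F = green
    p 1F = red
    p 2F = blue
    p 3F = purple

    n≡4k+2 : n ≡ 4 * (2 + j) + 2
    n≡4k+2 = trans (ℕ.+-comm 2 ((2 + j) * 4)) (cong (_+ 2) (ℕ.*-comm (2 + j) 4))

    -- Now the bound amounts to 4t ≤ 4j + 3 - r, which admits t = j for every residue, so all four
    -- runs have the same length.
    t<count : ∀ (r : Fin 4) t → 7 + (toℕ r + t * 4) ≤ n → t < 1 + j
    t<count r t le = ℕ.*-cancelʳ-< 4 t (1 + j)
      (s≤s (ℕ.≤-trans (ℕ.m≤n+m (t * 4) (toℕ r)) (ℕ.+-cancelˡ-≤ 7 _ _ le)))

    page : Fin 4 → List (ℕ × ℕ)
    page red    = (3 — 4 ∷ nested 1 (1 + j) ++ (9 + j * 4) — n ∷ []) ++ 1 — 2 ∷ []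
    page blue   = (4 — 5 ∷ []) ++ nested 2 (1 + j) ++ 1 — n ∷ 2 — 3 ∷ []
    page green  = nested 0 (1 + j) ++ 1 — (8 + j * 4) ∷ 2 — (9 + j * 4) ∷ 3 — n ∷ []
    page purple = 1 — 4 ∷ 2 — 5 ∷ 3 — 6 ∷ nested 3 (1 + j)

    twist⊆page : ∀ {i e} → e ∈ twist n i → e ∈ page i
    twist⊆page {red}    (here e≡)                 =
      ∈-++⁺ʳ (3 — 4 ∷ nested 1 (1 + j) ++ (9 + j * 4) — n ∷ []) (here e≡)
    twist⊆page {red}    (there (here e≡))         = here e≡
    twist⊆page {blue}   (here e≡)                 = there (∈-++⁺ʳ (nested 2 (1 + j)) (there (here e≡)))
    twist⊆page {blue}   (there (here e≡))         = there (∈-++⁺ʳ (nested 2 (1 + j)) (here e≡))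
    twist⊆page {green}  (here e≡)                 = ∈-++⁺ʳ (nested 0 (1 + j)) (there (there (here e≡)))
    twist⊆page {green}  (there (here e≡))         = ∈-++⁺ʳ (nested 0 (1 + j)) (there (here e≡))
    twist⊆page {green}  (there (there (here e≡))) = ∈-++⁺ʳ (nested 0 (1 + j)) (here e≡)
    twist⊆page {purple} (here e≡)                 = here e≡
    twist⊆page {purple} (there (here e≡))         = there (here e≡)
    twist⊆page {purple} (there (there (here e≡))) = there (there (here e≡))

    remaining⊆page : ∀ {i e} → e ∈ remaining-4k+2 n (2 + j) i → e ∈ page i
    remaining⊆page {red}    e∈ = there (∈-++⁺ˡ e∈)
    remaining⊆page {blue}   e∈ with ∈-++⁻ (nested 2 (1 + j)) e∈
    ... | inj₁ e∈nested  = there (∈-++⁺ˡ e∈nested)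
    ... | inj₂ (here e≡) = here e≡
    remaining⊆page {green}  e∈ = ∈-++⁺ˡ e∈
    remaining⊆page {purple} e∈ = there (there (there e∈))

    hasColour⁻ : ∀ {i e} → HasColour n i e → e ∈ twist n i ⊎ e ∈ remaining-4k+2 n (2 + j) i
    hasColour⁻ (inTwist e∈)      = inj₁ e∈
    hasColour⁻ (in-4k k n≡ e∈)   =
      contradiction (trans (ℕ.*-comm k 4) (trans (sym n≡) n≡4k+2)) (4a≢4b+2 k (2 + j))
    hasColour⁻ (in-4k+2 k n≡ e∈)
      with refl ← ℕ.*-cancelˡ-≡ (2 + j) k 4 (ℕ.+-cancelʳ-≡ 2 _ _ (trans (sym n≡4k+2) n≡)) = inj₂ e∈

  describes-4k+2 : ∀ 8≤n → Describes (2 + j * 4) 8≤n (periodic p) blue red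
  describes-4k+2 8≤n = record
    { sound    = [ twisted , sound ]′ ∘ hasColour⁻
    ; complete = [ inTwist , in-4k+2 (2 + j) n≡4k+2 ]′ ∘ edge⇒∈ (2 + j * 4) 8≤n p blue red (remaining-4k+2 n (2 + j))
        (λ _ → 1 + j) t<count
        (λ { 0F → id ; 1F → ∈-++⁺ˡ ; 2F → ∈-++⁺ˡ ; 3F → id })
        (∈-++⁺ʳ (nested 2 (1 + j)) (here refl)) (∈-++⁺ʳ (nested 1 (1 + j)) (here refl))
    ; page     = page
    ; planar   = λ
        { red    → 4 , 4 + n , arc (inj₂ (refl , refl)) (planar-nested n 1 (1 + j) ⋆ arc (inj₁ (refl , refl)) [])
                     ⋆ arc (inj₂ (refl , refl)) []
        ; blue   → 4 , 4 + n , arc (inj₁ (refl , refl)) [] ⋆ planar-nested n 2 (1 + j)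
                     ⋆ arc (inj₂ (refl , refl)) (arc (inj₂ (refl , refl)) [])
        ; green  → 4 , 4 + n , planar-nested n 0 (1 + j)
                     ⋆ arc (inj₂ (refl , refl)) (arc (inj₂ (refl , refl)) (arc (inj₂ (refl , refl)) []))
        ; purple → 4 , 4 + n , arc (inj₂ (refl , refl)) (arc (inj₂ (refl , refl)) (arc (inj₂ (refl , refl))
                     (planar-nested n 3 (1 + j))))
        }
    ; on-page  = λ {i} → [ twist⊆page {i} , remaining⊆page {i} ]′ ∘ hasColour⁻
    }
    where
    nested⇒ = nested⇒edge (2 + j * 4) 8≤n p blue red

    sound : ∀ {i e} → e ∈ remaining-4k+2 n (2 + j) i → Edge (2 + j * 4) 8≤n (periodic p) blue red i e
    sound {red}    e∈ with ∈-++⁻ (nested 1 (1 + j)) e∈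
    ... | inj₁ e∈nested    = nested⇒ 1F (1 + j) (ℕ.m≤n+m _ 2) e∈nested
    ... | inj₂ (here refl) = last refl
    sound {blue}   e∈ with ∈-++⁻ (nested 2 (1 + j)) e∈
    ... | inj₁ e∈nested    = nested⇒ 2F (1 + j) (ℕ.m≤n+m _ 1) e∈nested
    ... | inj₂ (here refl) = first refl
    sound {green}  e∈ = nested⇒ 0F (1 + j) (ℕ.m≤n+m _ 3) e∈
    sound {purple} e∈ = nested⇒ 3F (1 + j) ℕ.≤-refl e∈

-- Even n from 8 on as one of the two cases.

even-mod-4 : ∀ q → ∃[ j ] (q * 2 ≡ j * 4 ⊎ q * 2 ≡ 2 + j * 4)
even-mod-4 0 = 0 , inj₁ refl
even-mod-4 1 = 0 , inj₂ refl
even-mod-4 (suc (suc q)) with even-mod-4 q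
... | j , inj₁ eq = suc j , inj₁ (cong (4 +_) eq)
... | j , inj₂ eq = suc j , inj₂ (cong (4 +_) eq)

8≤even : ∀ {n} → 8 ≤ n → 2 ∣ n → ∃[ j ] (n ≡ 8 + j * 4 ⊎ n ≡ 10 + j * 4)
8≤even 8≤n (divides q refl) with ℕ.m≤n⇒∃[o]m+o≡n (ℕ.*-cancelʳ-≤ 4 q 2 8≤n)
... | q′ , refl with even-mod-4 q′
...   | j , inj₁ eq = j , inj₁ (cong (8 +_) eq)
...   | j , inj₂ eq = j , inj₂ (cong (8 +_) eq)

theorem1 : (n : ℕ) (8≤n : 8 ≤ n) → 2 ∣ n → IsDispersableMatchingBookEmbedding (C[ n ,⟨1,3⟩] 8≤n) (τ n) (colouring n)
theorem1 n 8≤n 2∣n = cases (8≤even 8≤n 2∣n)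
  where
  cases : ∃[ j ] (n ≡ 8 + j * 4 ⊎ n ≡ 10 + j * 4) →
          IsDispersableMatchingBookEmbedding (C[ n ,⟨1,3⟩] 8≤n) (τ n) (colouring n)
  cases (j , inj₁ refl) = isDispersable (j * 4) 8≤n _ _ _ (describes-4k j 8≤n)
  cases (j , inj₂ refl) = isDispersable (2 + j * 4) 8≤n _ _ _ (describes-4k+2 j 8≤n)
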